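{- Let $m,n,r$ be integers with $n \ge m > r \ge 0$. Then, as $H\to\infty$, \[ \#\mathcal{L}_{m,n,r}(\mathbb{Q};H) \le \begin{cases} H^{2mr+nr+n-r^2-r+o(1)}, & \text{if } 2m \ge n+r,\\ H^{2nr+2m-2r+o(1)}, & \text{if } 2m < n+r.\end{cases} \]
   Context: For a real $H\ge 1$, let $\mathcal{F}(H)=\{a/b:\ a,b\in\mathbb{Z},\ 0\le |a|,b\le H,\ \gcd(a,b)=1\}$ be the set of rationals in lowest terms of naive height at most $H$. Let $\mathcal{M}_{m,n}(\mathbb{Q};H)$ be the set of $m\times n$ matrices all of whose entries lie in $\mathcal{F}(H)$, and let $\mathcal{L}_{m,n,r}(\mathbb{Q};H)=\{A\in\mathcal{M}_{m,n}(\mathbb{Q};H):\ \operatorname{rank}A=r\}$. Here $m,n,r$ are fixed and $H\to\infty$; a bound $X\le H^{c+o(1)}$ means that for every $\varepsilon>0$ one has $X\le H^{c+\varepsilon}$ for all sufficiently large $H$ (depending on $\varepsilon,m,n,r$). -}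

module Defs where

open import Data.Nat using (ℕ; zero; suc; _+_; _*_; _∸_; _≤_; _<_; _≤?_)
open import Data.Integer using (∣_∣)
open import Data.Rational using (ℚ; ↥_; ↧ₙ_; 0ℚ) renaming (_+_ to _+ℚ_; _*_ to _*ℚ_)
open import Data.Vec using (Vec; []; _∷_; map; zipWith; replicate; lookup; tabulate)
open import Data.Fin using (Fin)
open import Data.Product using (Σ; _×_)
open import Relation.Binary.PropositionalEquality using (_≡_)
open import Relation.Nullary using (¬_; yes; no)
open import Function.Definitions using (Injective)

Matrix : ℕ → ℕ → Set
Matrix m n = Vec (Vec ℚ n) m

-- q ∈ 𝓕(H): q = a/b in lowest terms with |a| ≤ H, b ≤ H.
-- A stdlib ℚ is stored in lowest terms with positive denominator,
-- so this is exactly: |numerator| ≤ H and denominator ≤ H.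
InF : ℕ → ℚ → Set
InF H q = ∣ ↥ q ∣ ≤ H × ↧ₙ q ≤ H

InM : ∀ {m n} → ℕ → Matrix m n → Set
InM H A = ∀ i j → InF H (lookup (lookup A i) j)

linComb : ∀ {k n} → Vec ℚ k → Vec (Vec ℚ n) k → Vec ℚ n
linComb {n = n} [] [] = replicate n 0ℚ
linComb (c ∷ cs) (v ∷ vs) = zipWith _+ℚ_ (map (c *ℚ_) v) (linComb cs vs)

LinIndep : ∀ {k n} → Vec (Vec ℚ n) k → Set
LinIndep {k} {n} vs = ∀ (c : Vec ℚ k) → linComb c vs ≡ replicate n 0ℚ → c ≡ replicate k 0ℚ

rowsAt : ∀ {k m n} → Matrix m n → (Fin k → Fin m) → Vec (Vec ℚ n) k
rowsAt A σ = tabulate (λ i → lookup A (σ i))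

HasRank : ∀ {m n} → Matrix m n → ℕ → Set
HasRank {m} A r =
  Σ (Fin r → Fin m) (λ σ → Injective _≡_ _≡_ σ × LinIndep (rowsAt A σ))
  × (∀ (τ : Fin (suc r) → Fin m) → Injective _≡_ _≡_ τ → ¬ LinIndep (rowsAt A τ))

expo : ℕ → ℕ → ℕ → ℕ
expo m n r with n + r ≤? 2 * m
... | yes _ = (2 * m * r + n * r + n) ∸ (r * r + r)
... | no  _ = (2 * n * r + 2 * m) ∸ (2 * r)

{-# OPTIONS --safe #-}

module Submission where

open import Defs
open import Data.Empty using (⊥; ⊥-elim)
open import Data.Fin using (Fin; zero; suc; toℕ; fromℕ<)
import Data.Fin.Properties as Finₚ
open import Data.List as List using (List; []; _∷_; length)
import Data.List.Properties as Listₚ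
open import Data.List.Relation.Unary.All as All using (All; []; _∷_)
import Data.List.Relation.Unary.All.Properties as Allₚ
open import Data.List.Relation.Unary.AllPairs as AllPairs using (AllPairs; []; _∷_)
open import Data.List.Relation.Unary.Unique.Propositional using (Unique)
open import Data.Nat as ℕ using (ℕ; zero; suc; _≤_; _<_; z≤n; s≤s; s≤s⁻¹; _≤?_; >-nonZero; NonZero)
import Data.Nat.Properties as ℕₚ
import Data.Nat.Solver as ℕSolver
open import Data.Product using (Σ; _×_; _,_; proj₁; proj₂)
import Data.Product.Properties as Productₚ
open import Data.Rational as ℚ using (ℚ; mkℚ; ↥_; ↧ₙ_; ↧_; 0ℚ; 1ℚ)
import Data.Rational.Properties as ℚₚ
import Data.Rational.Solver as ℚSolver
open import Data.Sum using (_⊎_; inj₁; inj₂)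
open import Data.Unit using (⊤; tt)
open import Data.Vec as Vec using (Vec; []; _∷_; lookup; head; tail)
import Data.Vec.Properties as Vecₚ
open import Function using (_∘_; _$_; id)
open import Function.Definitions using (Injective)
open import Relation.Binary using (DecidableEquality)
open import Relation.Binary.PropositionalEquality
open import Relation.Nullary using (¬_; Dec; yes; no)
open import Relation.Nullary.Decidable using (decidable-stable; ¬?)
open import Relation.Unary using (Decidable)

-- Let the rows σ of A form a basis of its row space, write every row as a combination of them, and let
-- h be the largest number of terms in such a combination. Choose columns π such that the σ × π block B
-- is invertible. There are H^(2r²) blocks B. Given B, each of the m - r other coefficient rows has
-- O(H^(2h)) values, since it combines at most h rows of B into a vector with entries in 𝓕(H). Given the
-- coefficients, each of the n - r other columns solves a fixed linear equation with h + 1 nonzero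
-- terms, which leaves H^(2(r - h) + h + 1 + o(1)) possibilities. The total exponent is linear in h, so it is
-- largest at h = r or at h = 1, which gives the two cases.
--
-- For the solutions xᵢ = aᵢ/bᵢ of Σ eᵢ xᵢ = 0, let dᵢ be least with bᵢ ∣ eᵢ d₁ ⋯ dᵢ. Then aᵢ is determined
-- modulo dᵢ by the bs and the later as, so xᵢ is encoded by nᵢ = dᵢ (⌊(aᵢ + H) / dᵢ⌋ + 1) ≤ 3H together with
-- the choice of dᵢ as a divisor of nᵢ and of bᵢ as a divisor of eᵢ d₁ ⋯ dᵢ; by the divisor bound these
-- choices cost only H^o(1).

-- The coefficients of a row combination may have height above `H`, so they are not counted by
-- height: multiplied into the invertible block `B` they give entries of `A`, which lie in 𝓕(H), and
-- invertibility lets them be read back. Their height matters at one place only. The divisor bound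
-- is applied to the integers eᵢ d₁ ⋯ dᵢ, which must stay below a fixed power of `H`; elimination
-- shows that the coefficients have height polynomial in `H`, and the degree of that polynomial does
-- not reach the final exponent.
--
-- A row with the most terms serves two purposes: its `h` bounds the freedom of every other
-- coefficient row, and its relation involves as many coordinates of a column as possible.
--
-- The equation does not survive an induction over coordinates, because the removed ones leave a sum
-- that is no longer fixed. What survives is that the remaining sum, times d₁ ⋯ dᵢ, is an integer.
--
-- The rank hypothesis gives linear dependence only as a negation, so coefficients exist only up to
-- double negation. This suffices, since an inequality between natural numbers is decidable.

-- Counting by fibres, injections and case distinctions.

module Counting where

  open import Data.Nat using (_+_; _*_)
  open import Data.List using (_++_; filter; deduplicate; upTo; allFin) renaming (map to mapL)
  open import Data.List.Relation.Unary.Any using (here; there)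
  import Data.List.Relation.Unary.AllPairs.Properties as AllPairsₚ
  import Data.List.Relation.Unary.Unique.DecPropositional.Properties as DecUnique
  open import Data.List.Membership.Propositional using (_∈_)
  open import Data.List.Membership.Propositional.Properties
    using (∈-∃++; ∈-++⁺ˡ; ∈-++⁺ʳ; ∈-++⁻; ∈-upTo⁺; ∈-allFin; ∈-deduplicate⁺; ∈-map⁺)

  -- A bound on cardinality that needs neither a decidable P nor an enumeration of it.
  Count : {X : Set} (P : X → Set) (N : ℕ) → Set
  Count {X} P N = ∀ (L : List X) → Unique L → All P L → length L ≤ N

  count-⊆ : {X : Set} {P Q : X → Set} {M N : ℕ} →
    (∀ x → P x → Q x) → M ≤ N → Count Q M → Count P N
  count-⊆ P⊆Q M≤N c L u a = ℕₚ.≤-trans (c L u (All.map (P⊆Q _) a)) M≤N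

  -- Pigeonhole without decidable equality: membership of the head splits `ys` around one
  -- occurrence, and uniqueness keeps all later elements in what is left after cutting it out.
  count-list : {X : Set} {P : X → Set} (ys : List X) → (∀ x → P x → x ∈ ys) → Count P (length ys)
  count-list ys P∈ [] _ _ = z≤n
  count-list {X} {P} ys P∈ (x ∷ L) (x∉L ∷ u) (px ∷ a) with ∈-∃++ (P∈ x px)
  ... | as , bs , refl = begin
      suc (length L)                ≤⟨ s≤s (count-list (as ++ bs) (λ _ → id) L u
                                         (All.zipWith (λ (x≢y , py) → remove x≢y (P∈ _ py)) (x∉L , a))) ⟩
      suc (length (as ++ bs))       ≡⟨ cong suc (Listₚ.length-++ as) ⟩
      suc (length as + length bs)   ≡⟨ ℕₚ.+-suc (length as) (length bs) ⟨
      length as + length (x ∷ bs)   ≡⟨ Listₚ.length-++ as ⟨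
      length (as ++ x ∷ bs)         ∎
    where
    open ℕₚ.≤-Reasoning
    remove : ∀ {y} → x ≢ y → y ∈ as ++ x ∷ bs → y ∈ as ++ bs
    remove x≢y y∈ with ∈-++⁻ as y∈
    ... | inj₁ y∈as = ∈-++⁺ˡ y∈as
    ... | inj₂ (here y≡x) = ⊥-elim (x≢y (sym y≡x))
    ... | inj₂ (there y∈bs) = ∈-++⁺ʳ as y∈bs

  length-filter-split : {X : Set} {P : X → Set} (P? : Decidable P) (L : List X) →
    length L ≡ length (filter P? L) + length (filter (¬? ∘ P?) L)
  length-filter-split P? [] = refl
  length-filter-split P? (x ∷ L) with P? x
  ... | yes _ = cong suc (length-filter-split P? L)
  ... | no _ = trans (cong suc (length-filter-split P? L)) (sym (ℕₚ.+-suc _ _))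

  module _ {X Y : Set} (_≟_ : DecidableEquality Y) {P : X → Set} {Q : Y → Set} {R : X → Y → Set} where

    private
      Apart : X × Y → X × Y → Set
      Apart z w = proj₁ z ≢ proj₁ w

      Good : X × Y → Set
      Good (x , y) = P x × Q y × R x y

      choose : ∀ (L : List X) → All (λ x → P x × (Σ Y λ y → Q y × R x y)) L →
        Σ (List (X × Y)) λ zs → mapL proj₁ zs ≡ L × All Good zs
      choose [] [] = [] , refl , []
      choose (x ∷ L) ((px , y , qy , r) ∷ a) with choose L a
      ... | zs , refl , g = (x , y) ∷ zs , refl , (px , qy , r) ∷ g

      fibres : ∀ {N} → (∀ y → Q y → Count (λ x → P x × R x y) N) →
        ∀ (ys : List Y) zs → AllPairs Apart zs → All Good zs → All ((_∈ ys) ∘ proj₂) zs →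
        length zs ≤ length ys * N
      fibres f [] [] _ _ _ = z≤n
      fibres f [] (z ∷ zs) _ _ (() ∷ _)
      fibres {N} f (y ∷ ys) zs ap g m = begin
        length zs                                       ≡⟨ length-filter-split here? zs ⟩
        length here-zs + length (filter (¬? ∘ here?) zs) ≤⟨ ℕₚ.+-mono-≤ (bound here-zs
                                                              (AllPairsₚ.filter⁺ here? ap)
                                                              (Allₚ.filter⁺ here? g)
                                                              (Allₚ.all-filter here? zs)) rest ⟩
        N + length ys * N                               ∎
        where
        open ℕₚ.≤-Reasoning
        here? : Decidable (λ (z : X × Y) → proj₂ z ≡ y)
        here? z = proj₂ z ≟ y
        here-zs : List (X × Y)
        here-zs = filter here? zs
        bound : ∀ ws → AllPairs Apart ws → All Good ws → All (λ z → proj₂ z ≡ y) ws → length ws ≤ N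
        -- The bound `f` asks for a proof of `Q y`, which here only an element of the fibre
        -- provides; hence the separate empty case.
        bound [] _ _ _ = z≤n
        bound ws@((x , .y) ∷ _) ap′ g′@((_ , qy , _) ∷ _) e@(refl ∷ _) =
          subst (_≤ N) (Listₚ.length-map proj₁ ws)
            (f y qy (mapL proj₁ ws) (AllPairsₚ.map⁺ ap′)
              (Allₚ.map⁺ (All.zipWith (λ { ((p , _ , r) , refl) → p , r }) (g′ , e))))
        rest : length (filter (¬? ∘ here?) zs) ≤ length ys * N
        rest = fibres f ys _ (AllPairsₚ.filter⁺ (¬? ∘ here?) ap) (Allₚ.filter⁺ (¬? ∘ here?) g)
          (All.zipWith (λ { (ne , here e) → ⊥-elim (ne e) ; (_ , there i) → i })
            (Allₚ.all-filter (¬? ∘ here?) zs , Allₚ.filter⁺ (¬? ∘ here?) m))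

    -- Each `x` in the list receives one chosen `y`, and the list is grouped by that choice. `R` is
    -- a relation, so `y` may be any witness. `N` is uniform, but the argument for it may use the
    -- fixed `y`; nested uses with ever more data fixed carry the whole count.
    count-fibre : ∀ {M N} → Count Q M → (∀ x → P x → Σ Y λ y → Q y × R x y) →
      (∀ y → Q y → Count (λ x → P x × R x y) N) → Count P (M * N)
    count-fibre {M} {N} cQ tot f L u a with choose L (All.map (λ {x} p → p , tot x p) a)
    ... | zs , refl , g = begin
        length (mapL proj₁ zs) ≡⟨ Listₚ.length-map proj₁ zs ⟩
        length zs              ≤⟨ fibres f ys zs (AllPairsₚ.map⁻ u) g
                                    (All.tabulate λ z∈ → ∈-deduplicate⁺ _≟_ (∈-map⁺ proj₂ z∈)) ⟩
        length ys * N          ≤⟨ ℕₚ.*-monoˡ-≤ N (cQ ys (DecUnique.deduplicate-! _≟_ _)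
                                    (Allₚ.deduplicate⁺ _≟_ (Allₚ.map⁺ (All.map (λ (_ , q , _) → q) g)))) ⟩
        M * N                  ∎
      where
      open ℕₚ.≤-Reasoning
      ys : List Y
      ys = deduplicate _≟_ (mapL proj₂ zs)

  count-≤1 : {X : Set} {P : X → Set} → (∀ x y → P x → P y → x ≡ y) → Count P 1
  count-≤1 same [] _ _ = z≤n
  count-≤1 same (x ∷ []) _ _ = s≤s z≤n
  count-≤1 same (x ∷ y ∷ _) ((x≢y ∷ _) ∷ _) (px ∷ py ∷ _) = ⊥-elim (x≢y (same x y px py))

  count-rel : {X Y : Set} → DecidableEquality Y → {P : X → Set} {Q : Y → Set} {M : ℕ}
    (R : X → Y → Set) → Count Q M → (∀ x → P x → Σ Y λ y → Q y × R x y) →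
    (∀ x x′ y → Q y → P x → P x′ → R x y → R x′ y → x ≡ x′) → Count P M
  count-rel _≟_ {M = M} R cQ tot inj =
    subst (Count _) (ℕₚ.*-identityʳ M)
      (count-fibre _≟_ {R = R} cQ tot λ y qy → count-≤1 λ x x′ (px , r) (px′ , r′) → inj x x′ y qy px px′ r r′)

  count-inj : {X Y : Set} → DecidableEquality Y → {P : X → Set} {Q : Y → Set} {M : ℕ}
    (f : X → Y) → Count Q M → (∀ x → P x → Q (f x)) →
    (∀ x x′ → P x → P x′ → f x ≡ f x′ → x ≡ x′) → Count P M
  count-inj _≟_ f cQ pq inj = count-rel _≟_ (λ x y → f x ≡ y) cQ (λ x px → f x , pq x px , refl)
    (λ x x′ y _ px px′ e e′ → inj x x′ px px′ (trans e (sym e′)))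

  count-⊎ : {X : Set} {P Q R : X → Set} {M N : ℕ} → (∀ x → P x → Q x ⊎ R x) →
    Count Q M → Count R N → Count P (M + N)
  count-⊎ {X} {P} {Q} {R} split cQ cR L u a with go L u a
    where
    go : ∀ L → Unique L → All P L → Σ (List X) λ L₁ → Σ (List X) λ L₂ →
      length L ≡ length L₁ + length L₂ × Unique L₁ × Unique L₂ × All Q L₁ × All R L₂ ×
      -- Uniqueness of the two parts rests on this clause, with inequality to the new head as `S`.
      (∀ {S : X → Set} → All S L → All S L₁ × All S L₂)
    go [] _ _ = [] , [] , refl , [] , [] , [] , [] , λ _ → [] , []
    go (x ∷ L) (n ∷ u) (p ∷ a) with go L u a | split x p
    ... | L₁ , L₂ , e , u₁ , u₂ , a₁ , a₂ , s | inj₁ q =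
      x ∷ L₁ , L₂ , cong suc e , proj₁ (s n) ∷ u₁ , u₂ , q ∷ a₁ , a₂ ,
      λ { (h ∷ t) → h ∷ proj₁ (s t) , proj₂ (s t) }
    ... | L₁ , L₂ , e , u₁ , u₂ , a₁ , a₂ , s | inj₂ r =
      L₁ , x ∷ L₂ , trans (cong suc e) (sym (ℕₚ.+-suc _ _)) , u₁ , proj₂ (s n) ∷ u₂ , a₁ , r ∷ a₂ ,
      λ { (h ∷ t) → proj₁ (s t) , h ∷ proj₂ (s t) }
  ... | L₁ , L₂ , e , u₁ , u₂ , a₁ , a₂ , _ =
    subst (_≤ _) (sym e) (ℕₚ.+-mono-≤ (cQ L₁ u₁ a₁) (cR L₂ u₂ a₂))

  count-∅ : {X : Set} {P : X → Set} → (∀ x → ¬ P x) → Count P 0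
  count-∅ none [] _ _ = z≤n
  count-∅ none (x ∷ _) _ (px ∷ _) = ⊥-elim (none x px)

  count-< : ∀ n → Count (_< n) n
  count-< n = subst (Count _) (Listₚ.length-upTo n) (count-list (upTo n) λ _ → ∈-upTo⁺)

  count-Fin : ∀ {n} (P : Fin n → Set) → Count P n
  count-Fin {n} P = subst (Count _) (Listₚ.length-tabulate id) (count-list (allFin n) λ x _ → ∈-allFin x)

  -- The list is finite, so its double negations combine into one, and the inequality to be proved
  -- is decidable and hence stable.
  count-¬¬ : {X : Set} {P Q : X → Set} {N : ℕ} → (∀ x → P x → ¬ ¬ Q x) → Count Q N → Count P N
  count-¬¬ {X} {P} {Q} {N} pq cQ L u a = decidable-stable (length L ≤? N) λ k → go L a λ b → k (cQ L u b)
    where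
    go : ∀ L → All P L → ¬ ¬ All Q L
    go [] [] k = k []
    go (x ∷ L) (p ∷ a) k = pq x p λ q → go L a λ b → k (q ∷ b)

  count-× : {X Y : Set} → DecidableEquality X → DecidableEquality Y →
    {P : X → Set} {Q : Y → Set} {M N : ℕ} → Count P M → Count Q N →
    Count (λ (z : X × Y) → P (proj₁ z) × Q (proj₂ z)) (M * N)
  count-× _≟₁_ _≟₂_ cP cQ = count-fibre _≟₁_ {R = λ z x → proj₁ z ≡ x} cP
    (λ (x , y) (p , q) → x , p , refl)
    λ x _ → count-inj _≟₂_ proj₂ cQ (λ _ ((_ , q) , _) → q)
      λ { (x , y) (x′ , y′) (_ , refl) (_ , refl) refl → refl }

  ∏ : ∀ {n} → (Fin n → ℕ) → ℕ
  ∏ {zero} f = 1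
  ∏ {suc n} f = f zero * ∏ (f ∘ suc)

  count-Vec : {X : Set} → DecidableEquality X → ∀ {n} {P : Fin n → X → Set} {N : Fin n → ℕ} →
    (∀ i → Count (P i) (N i)) → Count (λ v → ∀ i → P i (lookup v i)) (∏ N)
  count-Vec _≟_ {zero} c = count-≤1 λ { [] [] _ _ → refl }
  count-Vec _≟_ {suc n} {P} c =
    count-inj (×-≟ _≟_ (Vecₚ.≡-dec _≟_)) (λ v → Vec.head v , Vec.tail v)
      (count-× _≟_ (Vecₚ.≡-dec _≟_) (c zero) (count-Vec _≟_ {P = P ∘ suc} (c ∘ suc)))
      (λ { (x ∷ v) p → p zero , p ∘ suc })
      λ { (x ∷ v) (.x ∷ .v) _ _ refl → refl }
    where open import Data.Product.Properties using () renaming (≡-dec to ×-≟)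

open Counting

-- The divisor bound: an integer n has n^o(1) divisors.

module Divisors where

  open import Data.Nat using (_+_; _*_; _^_; _∸_; _/_; _%_; nonTrivial⇒n>1)
  open import Data.Nat.Coprimality using (Coprime; coprime-divisor)
  open import Data.Nat.Divisibility using (_∣_; divides; _∣?_; ∣-trans; m∣m*n; n∣m*n; *-cancelˡ-∣; ∣1⇒≡1)
  open import Data.Nat.DivMod using (m/n*n≤m; m≡m%n+[m/n]*n; m%n<n)
  open import Data.Nat.ListAction using (product)
  open import Data.Nat.Primality using (Prime; prime?; prime⇒irreducible; prime⇒nonZero; prime⇒nonTrivial)
  open import Data.Nat.Primality.Factorisation using (factorise; PrimeFactorisation)
  open ℕSolver using (module +-*-Solver)

  open ℕₚ.≤-Reasoning

  private
    pos*ˡ : ∀ {a b} → 0 < a * b → 0 < a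
    pos*ˡ {suc a} _ = s≤s z≤n

    pos*ʳ : ∀ {a b} → 0 < a * b → 0 < b
    pos*ʳ {a} {b} h = pos*ˡ (subst (0 <_) (ℕₚ.*-comm a b) h)

  ^-distrib-* : ∀ a b k → (a * b) ^ k ≡ a ^ k * b ^ k
  ^-distrib-* a b zero = refl
  ^-distrib-* a b (suc k) rewrite ^-distrib-* a b k =
    solve 4 (λ a b x y → a :* b :* (x :* y) := a :* x :* (b :* y)) refl a b (a ^ k) (b ^ k)
    where open +-*-Solver

  ^-cancelʳ-≤ : ∀ k {a b} → a ^ suc k ≤ b ^ suc k → a ≤ b
  ^-cancelʳ-≤ k {a} {b} h with a ≤? b
  ... | yes p = p
  ... | no q = ⊥-elim (ℕₚ.<⇒≱ (ℕₚ.^-monoˡ-< (suc k) (ℕₚ.≰⇒> q)) h)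

  prime∤⇒coprime : ∀ {p e} → Prime p → ¬ p ∣ e → Coprime e p
  prime∤⇒coprime pp p∤e (d∣e , d∣p) with prime⇒irreducible pp d∣p
  ... | inj₁ d≡1 = d≡1
  ... | inj₂ refl = ⊥-elim (p∤e d∣e)

  -- If `p` divides `e`, one factor `p` cancels on both sides; otherwise `e` is coprime to `p` and
  -- divides the product with one factor fewer. `m` may itself be divisible by `p`: the
  -- decomposition is then not unique, which an upper bound tolerates.
  divisor-prime-power : ∀ {p} → Prime p → ∀ a m e → e ∣ p ^ a * m →
    Σ ℕ λ j → j < suc a × Σ ℕ λ f → f ∣ m × e ≡ p ^ j * f
  divisor-prime-power pp zero m e e∣ = 0 , s≤s z≤n , e , subst (e ∣_) (ℕₚ.*-identityˡ m) e∣ , sym (ℕₚ.*-identityˡ e)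
  divisor-prime-power {p} pp (suc a) m e e∣ with p ∣? e
  ... | yes (divides q refl) with divisor-prime-power pp a m q
            (*-cancelˡ-∣ p {{prime⇒nonZero pp}} (subst₂ _∣_ (ℕₚ.*-comm q p) (ℕₚ.*-assoc p (p ^ a) m) e∣))
  ...   | j , j<a , f , f∣m , refl = suc j , s≤s j<a , f , f∣m ,
            trans (ℕₚ.*-comm (p ^ j * f) p) (sym (ℕₚ.*-assoc p (p ^ j) f))
  divisor-prime-power {p} pp (suc a) m e e∣ | no p∤e with divisor-prime-power pp a m e
            (coprime-divisor (prime∤⇒coprime pp p∤e) (subst (e ∣_) (ℕₚ.*-assoc p (p ^ a) m) e∣))
  ... | j , j<a , rest = j , ℕₚ.m≤n⇒m≤1+n j<a , rest

  count-divisors-prime-power : ∀ {p} → Prime p → ∀ a m {N} →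
    Count (_∣ m) N → Count (_∣ p ^ a * m) (suc a * N)
  count-divisors-prime-power {p} pp a m c =
    count-fibre ℕₚ._≟_ {R = λ e j → Σ ℕ λ f → f ∣ m × e ≡ p ^ j * f} (count-< (suc a))
      (λ e e∣ → divisor-prime-power pp a m e e∣)
      (λ j _ → count-rel ℕₚ._≟_ (λ e f → e ≡ p ^ j * f) c (λ _ → proj₂)
        λ { _ _ f _ _ _ refl refl → refl })

  private
    n<2^n : ∀ n → n < 2 ^ n
    n<2^n zero = s≤s z≤n
    n<2^n (suc n) = begin-strict
      suc n           <⟨ s≤s (n<2^n n) ⟩
      1 + 2 ^ n       ≤⟨ ℕₚ.+-monoˡ-≤ (2 ^ n) (ℕₚ.m^n>0 2 n) ⟩
      2 ^ n + 2 ^ n   ≡⟨ cong (2 ^ n +_) (ℕₚ.+-identityʳ (2 ^ n)) ⟨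
      2 ^ suc n       ∎

  -- Writing q = a / k, we have a < k (q + 1) ≤ k 2^q and 2^(q k) ≤ 2^a.
  exp-dominates-poly : ∀ k a → suc a ^ suc k ≤ suc k ^ suc k * 2 ^ a
  exp-dominates-poly k a = begin
    suc a ^ K                 ≤⟨ ℕₚ.^-monoˡ-≤ K (begin
       suc a                    ≡⟨ cong suc (m≡m%n+[m/n]*n a K) ⟩
       suc (a % K) + q * K ≤⟨ ℕₚ.+-monoˡ-≤ (q * K) (m%n<n a K) ⟩
       suc q * K                ≤⟨ ℕₚ.*-monoˡ-≤ K (n<2^n q) ⟩
       2 ^ q * K                ≡⟨ ℕₚ.*-comm (2 ^ q) K ⟩
       K * 2 ^ q                ∎) ⟩
    (K * 2 ^ q) ^ K           ≡⟨ ^-distrib-* K (2 ^ q) K ⟩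
    K ^ K * (2 ^ q) ^ K       ≡⟨ cong (K ^ K *_) (ℕₚ.^-*-assoc 2 q K) ⟩
    K ^ K * 2 ^ (q * K)       ≤⟨ ℕₚ.*-monoʳ-≤ (K ^ K) (ℕₚ.^-monoʳ-≤ 2 (m/n*n≤m a K)) ⟩
    K ^ K * 2 ^ a             ∎
    where
    K q : ℕ
    K = suc k
    q = a / K

  extract-power : ∀ p → 1 < p → ∀ fuel n → n ≤ fuel → 0 < n →
    Σ ℕ λ a → Σ ℕ λ m → n ≡ p ^ a * m × ¬ p ∣ m
  extract-power p 1<p zero n n≤ 0<n = ⊥-elim (ℕₚ.<⇒≱ 0<n n≤)
  extract-power p 1<p (suc fuel) n n≤ 0<n with p ∣? n
  ... | no p∤n = 0 , n , sym (ℕₚ.*-identityˡ n) , p∤n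
  ... | yes (divides q refl) with extract-power p 1<p fuel q
          (s≤s⁻¹ (ℕₚ.<-≤-trans (ℕₚ.m<m*n q p {{>-nonZero (pos*ˡ 0<n)}} 1<p) n≤)) (pos*ˡ 0<n)
  ...   | a , m , refl , p∤m = suc a , m ,
          trans (ℕₚ.*-comm (p ^ a * m) p) (sym (ℕₚ.*-assoc p (p ^ a) m)) , p∤m

  private
    step-bound : ∀ k a b C p^ N n → suc a ^ k ≤ b * p^ → N ^ k ≤ C * n → (suc a * N) ^ k ≤ b * C * (p^ * n)
    step-bound k a b C p^ N n h₁ h₂ = begin
      (suc a * N) ^ k      ≡⟨ ^-distrib-* (suc a) N k ⟩
      suc a ^ k * N ^ k    ≤⟨ ℕₚ.*-mono-≤ h₁ h₂ ⟩
      b * p^ * (C * n)     ≡⟨ solve 4 (λ b p C n → b :* p :* (C :* n) := b :* C :* (p :* n)) refl b p^ C n ⟩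
      b * C * (p^ * n)     ∎
      where open +-*-Solver

  module _ (k : ℕ) where

    private
      K y : ℕ
      K = suc k
      y = 2 ^ K

    -- The estimate (C n)^(1/K) for the number of divisors, without roots. Splitting off a prime
    -- power multiplies `N ^ K` and `n` separately, so only the constants accumulate.
    DivisorsBoundedBy : ℕ → ℕ → Set
    DivisorsBoundedBy C n = Σ ℕ λ N → Count (_∣ n) N × N ^ K ≤ C * n

    -- A prime p ≥ 2^K at most doubles the number of divisors, and 2^K ≤ p; each smaller prime costs a
    -- constant factor, because (a + 1)^K = O(2^a).
    divisors-large-primes : ∀ ps → All Prime ps → All (y ≤_) ps → DivisorsBoundedBy 1 (product ps)
    divisors-large-primes [] _ _ = 1 , count-≤1 (λ _ _ p q → trans (∣1⇒≡1 p) (sym (∣1⇒≡1 q))) ,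
      ℕₚ.≤-reflexive (ℕₚ.^-zeroˡ K)
    divisors-large-primes (p ∷ ps) (pp ∷ pps) (y≤p ∷ y≤ps) with divisors-large-primes ps pps y≤ps
    ... | N , c , h = 2 * N , subst (λ t → Count (_∣ t * product ps) (2 * N)) (ℕₚ.^-identityʳ p)
                        (count-divisors-prime-power pp 1 (product ps) c) ,
                      step-bound K 1 1 1 p N (product ps) (ℕₚ.≤-trans y≤p (ℕₚ.≤-reflexive (sym (ℕₚ.*-identityˡ p)))) h

    -- The primes below `2 ^ K` are divided out in increasing order, with `fuel` candidates left.
    -- `C` is chosen before `n`: it gains a factor `K ^ K` for each small prime and nothing for
    -- large ones, so it depends on `k` alone.
    divisors-primes≥ : ∀ fuel i → 2 ≤ i → i + fuel ≡ y → Σ ℕ λ C → ∀ n → 0 < n →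
      (∀ p → Prime p → p ∣ n → i ≤ p) → DivisorsBoundedBy C n
    divisors-primes≥ zero i _ i≡y = 1 , λ n 0<n large → go n 0<n large (factorise n {{>-nonZero 0<n}})
      where
      all-large : ∀ ps → All Prime ps → (∀ p → Prime p → p ∣ product ps → i ≤ p) → All (y ≤_) ps
      all-large [] _ _ = []
      all-large (p ∷ ps) (pp ∷ pps) l =
        subst (_≤ p) (trans (sym (ℕₚ.+-identityʳ i)) i≡y) (l p pp (m∣m*n (product ps)))
        ∷ all-large ps pps λ q pq q∣ → l q pq (∣-trans q∣ (n∣m*n p))
      go : ∀ n → 0 < n → (∀ p → Prime p → p ∣ n → i ≤ p) → PrimeFactorisation n → DivisorsBoundedBy 1 n
      go n _ l record { factors = ps ; isFactorisation = refl ; factorsPrime = pps } =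
        divisors-large-primes ps pps (all-large ps pps l)
    divisors-primes≥ (suc fuel) i 2≤i e
      with divisors-primes≥ fuel (suc i) (ℕₚ.m≤n⇒m≤1+n 2≤i) (trans (sym (ℕₚ.+-suc i fuel)) e) | prime? i
    ... | C , f | no ¬pi = C , λ n 0<n l → f n 0<n λ p pp p∣n → ℕₚ.≤∧≢⇒< (l p pp p∣n) λ { refl → ¬pi pp }
    ... | C , f | yes pi = K ^ K * C , λ n 0<n l → go n 0<n l (extract-power i 2≤i n n ℕₚ.≤-refl 0<n)
      where
      go : ∀ n → 0 < n → (∀ p → Prime p → p ∣ n → i ≤ p) →
        (Σ ℕ λ a → Σ ℕ λ m → n ≡ i ^ a * m × ¬ i ∣ m) → DivisorsBoundedBy (K ^ K * C) n
      go _ 0<n l (a , m , refl , i∤m) with f m (pos*ʳ {i ^ a} 0<n)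
        (λ p pp p∣m → ℕₚ.≤∧≢⇒< (l p pp (∣-trans p∣m (n∣m*n (i ^ a)))) λ { refl → i∤m p∣m })
      ... | N , c , h = suc a * N , count-divisors-prime-power pi a m c ,
        step-bound K a (K ^ K) C (i ^ a) N m
          (ℕₚ.≤-trans (exp-dominates-poly k a) (ℕₚ.*-monoʳ-≤ (K ^ K) (ℕₚ.^-monoˡ-≤ a 2≤i))) h

    divisors-bounded : Σ ℕ λ C → ∀ n → 0 < n → DivisorsBoundedBy C n
    divisors-bounded with divisors-primes≥ (y ∸ 2) 2 ℕₚ.≤-refl
      (ℕₚ.m+[n∸m]≡n (ℕₚ.^-monoʳ-≤ 2 {1} {K} (s≤s z≤n)))
    ... | C , f = C , λ n 0<n → f n 0<n λ p pp _ → nonTrivial⇒n>1 p {{prime⇒nonTrivial pp}}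

  floor-root : ∀ j H → Σ ℕ λ D → D ^ suc j ≤ H × (∀ N → N ^ suc j ≤ H → N ≤ D)
  floor-root j zero = 0 , z≤n , λ N h → ℕₚ.≤-reflexive (ℕₚ.m^n≡0⇒m≡0 N (suc j) (ℕₚ.n≤0⇒n≡0 h))
  floor-root j (suc H) with floor-root j H
  ... | D , h , max with suc D ^ suc j ≤? suc H
  ...   | yes p = suc D , p , λ N hN → ℕₚ.≮⇒≥ λ lt → ℕₚ.<⇒≱ (ℕₚ.n<1+n D)
            (max (suc D) (s≤s⁻¹ (ℕₚ.<-≤-trans (ℕₚ.^-monoˡ-< (suc j) lt) hN)))
  ...   | no p = D , ℕₚ.m≤n⇒m≤1+n h , λ N hN → ℕₚ.≮⇒≥ λ lt → p (ℕₚ.≤-trans (ℕₚ.^-monoˡ-≤ (suc j) lt) hN)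

  -- `D` is the integer part of the `suc j`-th root of `H`, a single number for all `n ≤ H ^ K`.
  -- Since `j` is free, any fixed power of `D` can be kept below `H`.
  divisor-bound : ∀ j K → Σ ℕ λ H₀ → ∀ H → H₀ ≤ H →
    Σ ℕ λ D → D ^ suc j ≤ H × (∀ n → 0 < n → n ≤ H ^ K → Count (_∣ n) D)
  -- This choice makes the exponent of `N` equal to `suc j * suc K`. The constant `C` is at most `H`
  -- and costs one more factor `H`, so `n ≤ H ^ K` leads to `H ^ suc K`, and the `suc K`-th root can
  -- be taken.
  divisor-bound j K with divisors-bounded (K + j * suc K)
  ... | C , f = C , λ H C≤H → let D , D≤ , max = floor-root j H in
    D , D≤ , λ n 0<n n≤ → let N , c , h = f n 0<n in
      count-⊆ (λ _ p → p) (max N (^-cancelʳ-≤ K (begin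
        (N ^ suc j) ^ suc K   ≡⟨ ℕₚ.^-*-assoc N (suc j) (suc K) ⟩
        N ^ (suc j * suc K)   ≤⟨ h ⟩
        C * n                 ≤⟨ ℕₚ.*-mono-≤ C≤H n≤ ⟩
        H ^ suc K             ∎))) c

open Divisors

-- Integers inside the rationals, the size of 𝓕(H), residues and quotients.

module Rationals where

  open import Data.Integer as ℤ using (ℤ; +_; -[1+_]; ∣_∣; 0ℤ)
  import Data.Integer.Properties as ℤₚ
  open import Data.Nat.Coprimality using (coprime-divisor; coprime-/gcd)
  open import Data.Nat.Divisibility using (_∣_; divides; *-cancelʳ-∣)
  open import Data.Nat.DivMod using (m/n*n≡m; m/n*n≤m; +-distrib-/-∣ʳ; m*n/n≡m)
  open import Data.Nat.GCD using (gcd; gcd[m,n]∣m; gcd[m,n]∣n; gcd[m,n]≡0⇒m≡0)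
  open import Data.Rational using (toℚᵘ; fromℚᵘ)
  open import Data.Rational.Unnormalised as ℚᵘ using (mkℚᵘ; *≡*)
  import Data.Rational.Unnormalised.Properties as ℚᵘₚ

  -- Abstract, since unfolding ι runs the gcd computations of ℚ.
  abstract

    ι : ℤ → ℚ
    ι z = fromℚᵘ (mkℚᵘ z 0)

    ιᵘ : ∀ z → toℚᵘ (ι z) ℚᵘ.≃ mkℚᵘ z 0
    ιᵘ z = ℚₚ.toℚᵘ-fromℚᵘ (mkℚᵘ z 0)

    ι-0 : ι 0ℤ ≡ 0ℚ
    ι-0 = refl

    ι-* : ∀ a b → ι (a ℤ.* b) ≡ ι a ℚ.* ι b
    ι-* a b = ℚₚ.toℚᵘ-injective (begin
      toℚᵘ (ι (a ℤ.* b))             ≈⟨ ιᵘ (a ℤ.* b) ⟩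
      mkℚᵘ a 0 ℚᵘ.* mkℚᵘ b 0         ≈⟨ ℚᵘₚ.*-cong (ℚᵘₚ.≃-sym (ιᵘ a)) (ℚᵘₚ.≃-sym (ιᵘ b)) ⟩
      toℚᵘ (ι a) ℚᵘ.* toℚᵘ (ι b)     ≈⟨ ℚᵘₚ.≃-sym (ℚₚ.toℚᵘ-homo-* (ι a) (ι b)) ⟩
      toℚᵘ (ι a ℚ.* ι b)             ∎)
      where open import Relation.Binary.Reasoning.Setoid ℚᵘₚ.≃-setoid

    ι-+ : ∀ a b → ι (a ℤ.+ b) ≡ ι a ℚ.+ ι b
    ι-+ a b = ℚₚ.toℚᵘ-injective (begin
      toℚᵘ (ι (a ℤ.+ b))             ≈⟨ ιᵘ (a ℤ.+ b) ⟩
      mkℚᵘ (a ℤ.+ b) 0               ≡⟨ cong (λ t → mkℚᵘ t 0) (cong₂ ℤ._+_ (ℤₚ.*-identityʳ a) (ℤₚ.*-identityʳ b)) ⟨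
      mkℚᵘ a 0 ℚᵘ.+ mkℚᵘ b 0         ≈⟨ ℚᵘₚ.+-cong (ℚᵘₚ.≃-sym (ιᵘ a)) (ℚᵘₚ.≃-sym (ιᵘ b)) ⟩
      toℚᵘ (ι a) ℚᵘ.+ toℚᵘ (ι b)     ≈⟨ ℚᵘₚ.≃-sym (ℚₚ.toℚᵘ-homo-+ (ι a) (ι b)) ⟩
      toℚᵘ (ι a ℚ.+ ι b)             ∎)
      where open import Relation.Binary.Reasoning.Setoid ℚᵘₚ.≃-setoid

    ι-neg : ∀ a → ι (ℤ.- a) ≡ ℚ.- ι a
    ι-neg a = ℚₚ.toℚᵘ-injective (begin
      toℚᵘ (ι (ℤ.- a))     ≈⟨ ιᵘ (ℤ.- a) ⟩
      ℚᵘ.- (mkℚᵘ a 0)      ≈⟨ ℚᵘₚ.-‿cong (ℚᵘₚ.≃-sym (ιᵘ a)) ⟩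
      ℚᵘ.- (toℚᵘ (ι a))    ≈⟨ ℚᵘₚ.≃-sym (ℚₚ.toℚᵘ-homo‿- (ι a)) ⟩
      toℚᵘ (ℚ.- ι a)       ∎)
      where open import Relation.Binary.Reasoning.Setoid ℚᵘₚ.≃-setoid

    ι-injective : ∀ {a b} → ι a ≡ ι b → a ≡ b
    ι-injective {a} {b} e with ℚₚ.fromℚᵘ-injective {mkℚᵘ a 0} {mkℚᵘ b 0} e
    ... | *≡* h = trans (sym (ℤₚ.*-identityʳ a)) (trans h (ℤₚ.*-identityʳ b))

    *-↧ : ∀ x → x ℚ.* ι (↧ x) ≡ ι (↥ x)
    *-↧ x@(mkℚ a d _) = ℚₚ.toℚᵘ-injective (begin
      toℚᵘ (x ℚ.* ι (↧ x))                ≈⟨ ℚₚ.toℚᵘ-homo-* x (ι (↧ x)) ⟩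
      mkℚᵘ a d ℚᵘ.* toℚᵘ (ι (↧ x))        ≈⟨ ℚᵘₚ.*-cong (ℚᵘₚ.≃-refl {mkℚᵘ a d}) (ιᵘ (↧ x)) ⟩
      mkℚᵘ a d ℚᵘ.* mkℚᵘ (↧ x) 0          ≈⟨ *≡* (trans (ℤₚ.*-identityʳ _)
                                              (cong (a ℤ.*_) (cong +_ (cong suc (sym (ℕₚ.*-identityʳ d)))))) ⟩
      mkℚᵘ a 0                            ≈⟨ ℚᵘₚ.≃-sym (ιᵘ a) ⟩
      toℚᵘ (ι (↥ x))                      ∎)
      where open import Relation.Binary.Reasoning.Setoid ℚᵘₚ.≃-setoid

  ↥↧-injective : ∀ {x y} → ↥ x ≡ ↥ y → ↧ₙ x ≡ ↧ₙ y → x ≡ y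
  ↥↧-injective {mkℚ _ _ _} {mkℚ _ _ _} refl refl = refl

  ↧ₙ>0 : ∀ x → 0 < ↧ₙ x
  ↧ₙ>0 (mkℚ _ _ _) = s≤s z≤n

  shift : ℕ → ℤ → ℕ
  shift H (+ n) = n ℕ.+ H
  shift H -[1+ n ] = H ℕ.∸ suc n

  shift-correct : ∀ H a → ∣ a ∣ ≤ H → + shift H a ≡ a ℤ.+ + H
  shift-correct H (+ n) _ = refl
  shift-correct H -[1+ n ] h = sym (ℤₚ.⊖-≥ h)

  shift-≤ : ∀ H a → ∣ a ∣ ≤ H → shift H a ≤ H ℕ.+ H
  shift-≤ H (+ n) h = ℕₚ.+-monoˡ-≤ H h
  shift-≤ H -[1+ n ] h = ℕₚ.≤-trans (ℕₚ.m∸n≤m H (suc n)) (ℕₚ.m≤m+n H H)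

  shift-injective : ∀ H {a b} → ∣ a ∣ ≤ H → ∣ b ∣ ≤ H → shift H a ≡ shift H b → a ≡ b
  shift-injective H {a} {b} ha hb e = ∙-cancelʳ (+ H) a b
    (trans (sym (shift-correct H a ha)) (trans (cong +_ e) (shift-correct H b hb)))
    where open import Algebra.Properties.AbelianGroup ℤₚ.+-0-abelianGroup

  private
    1+2H≤3H : ∀ {H} → 1 ≤ H → suc (H ℕ.+ H) ≤ 3 ℕ.* H
    1+2H≤3H {H} h = ℕₚ.≤-trans (ℕₚ.+-monoˡ-≤ (H ℕ.+ H) h)
      (ℕₚ.≤-reflexive (cong (λ t → H ℕ.+ (H ℕ.+ t)) (sym (ℕₚ.+-identityʳ H))))

  -- An upper bound, not the cardinality: `2H + 1` numerators and `H + 1` candidates for the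
  -- denominator, rounded up to a monomial in `H`.
  |𝓕| : ℕ → ℕ
  |𝓕| H = 3 ℕ.* H ℕ.* (2 ℕ.* H)

  count-𝓕 : ∀ {H} → 1 ≤ H → Count (InF H) (|𝓕| H)
  count-𝓕 {H} 1≤H = count-⊆ (λ _ p → p) (ℕₚ.*-mono-≤ (1+2H≤3H 1≤H)
      (ℕₚ.≤-trans (ℕₚ.+-monoˡ-≤ H 1≤H) (ℕₚ.≤-reflexive (cong (H ℕ.+_) (sym (ℕₚ.+-identityʳ H))))))
    (count-inj (×-≟ ℕₚ._≟_ ℕₚ._≟_) (λ x → shift H (↥ x) , ↧ₙ x)
      (count-× ℕₚ._≟_ ℕₚ._≟_ (count-< (suc (H ℕ.+ H))) (count-< (suc H)))
      (λ x (p , q) → s≤s (shift-≤ H (↥ x) p) , s≤s q)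
      λ x y (p , _) (q , _) e → ↥↧-injective (shift-injective H p q (cong proj₁ e)) (cong proj₂ e))
    where open import Data.Product.Properties using () renaming (≡-dec to ×-≟)

  -- The least d with b ∣ E d.
  cofactor : ℕ → ℕ → ℕ
  cofactor b E with gcd b E
  ... | zero = 0
  ... | suc g = b ℕ./ suc g

  module _ (b E : ℕ) (0<b : 0 < b) where

    private
      g≢0 : gcd b E ≢ 0
      g≢0 e = ℕₚ.<⇒≢ 0<b (sym (gcd[m,n]≡0⇒m≡0 e))

    -- With `b = d g` and `E = q g` for the gcd `g`, the condition `b ∣ E t` becomes `d ∣ q t`, and
    -- `d` is coprime to `q`. So `d` is least even for divisibility.
    cofactor-spec : (0 < cofactor b E) × (cofactor b E ∣ b) × (b ∣ E ℕ.* cofactor b E) ×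
      (∀ t → b ∣ E ℕ.* t → cofactor b E ∣ t)
    cofactor-spec with gcd b E in eq | g≢0 | gcd[m,n]∣m b E | gcd[m,n]∣n b E | coprime-/gcd b E
    ... | zero | ne | _ | _ | _ = ⊥-elim (ne refl)
    ... | suc g | _ | g∣b | g∣E | cop = d>0 , divides (suc g) (trans b≡ (ℕₚ.*-comm d (suc g))) ,
        divides q (trans (cong (ℕ._* d) E≡) (trans (ℕₚ.*-assoc q (suc g) d) (cong (q ℕ.*_) (trans (ℕₚ.*-comm (suc g) d) (sym b≡))))) ,
        λ t b∣ → coprime-divisor cop (*-cancelʳ-∣ (suc g) (subst₂ _∣_ b≡ (begin
          E ℕ.* t              ≡⟨ cong (ℕ._* t) E≡ ⟩
          q ℕ.* suc g ℕ.* t    ≡⟨ ℕₚ.*-assoc q (suc g) t ⟩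
          q ℕ.* (suc g ℕ.* t)  ≡⟨ cong (q ℕ.*_) (ℕₚ.*-comm (suc g) t) ⟩
          q ℕ.* (t ℕ.* suc g)  ≡⟨ ℕₚ.*-assoc q t (suc g) ⟨
          q ℕ.* t ℕ.* suc g    ∎) b∣))
      where
      open ≡-Reasoning
      d q : ℕ
      d = b ℕ./ suc g
      q = E ℕ./ suc g
      b≡ : b ≡ d ℕ.* suc g
      b≡ = sym (m/n*n≡m g∣b)
      E≡ : E ≡ q ℕ.* suc g
      E≡ = sym (m/n*n≡m g∣E)
      d>0 : 0 < d
      d>0 = ℕₚ.n≢0⇒n>0 λ e → ℕₚ.<⇒≢ 0<b (sym (trans b≡ (cong (ℕ._* suc g) e)))

  quot : ℕ → ℕ → ℕ
  quot u zero = 0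
  quot u d@(suc _) = u ℕ./ d

  quot-≤ : ∀ u d → d ℕ.* quot u d ≤ u
  quot-≤ u zero = z≤n
  quot-≤ u d@(suc _) = ℕₚ.≤-trans (ℕₚ.≤-reflexive (ℕₚ.*-comm d (u ℕ./ d))) (m/n*n≤m u d)

  private
    -- Adding `k * d` to `u` raises the quotient by exactly `k`, so equal quotients force `k = 0`.
    quot-injective-≤ : ∀ d u u′ → 0 < d → u ≤ u′ → d ∣ u′ ℕ.∸ u → quot u d ≡ quot u′ d → u ≡ u′
    quot-injective-≤ d@(suc _) u u′ _ u≤ (divides k eq) e =
      sym (trans u′≡ (trans (cong (u ℕ.+_) (trans eq (cong (ℕ._* d) k≡0))) (ℕₚ.+-identityʳ u)))
      where
      open ≡-Reasoning
      u′≡ : u′ ≡ u ℕ.+ (u′ ℕ.∸ u)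
      u′≡ = sym (ℕₚ.m+[n∸m]≡n u≤)
      k≡0 : k ≡ 0
      k≡0 = ℕₚ.+-cancelˡ-≡ (u ℕ./ d) k 0 (begin
        u ℕ./ d ℕ.+ k                      ≡⟨ cong (u ℕ./ d ℕ.+_) (m*n/n≡m k d) ⟨
        u ℕ./ d ℕ.+ (k ℕ.* d) ℕ./ d        ≡⟨ +-distrib-/-∣ʳ u (divides k refl) ⟨
        (u ℕ.+ k ℕ.* d) ℕ./ d              ≡⟨ cong (λ t → (u ℕ.+ t) ℕ./ d) eq ⟨
        (u ℕ.+ (u′ ℕ.∸ u)) ℕ./ d           ≡⟨ cong (ℕ._/ d) u′≡ ⟨
        u′ ℕ./ d                           ≡⟨ e ⟨
        u ℕ./ d                            ≡⟨ ℕₚ.+-identityʳ _ ⟨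
        u ℕ./ d ℕ.+ 0                      ∎)

  quot-injective : ∀ d u u′ → 0 < d → d ∣ ∣ + u ℤ.- + u′ ∣ → quot u d ≡ quot u′ d → u ≡ u′
  quot-injective d u u′ 0<d d∣ e with ℕₚ.≤-total u u′
  ... | inj₁ u≤ = quot-injective-≤ d u u′ 0<d u≤
        (subst (d ∣_) (trans (cong ∣_∣ (ℤₚ.m-n≡m⊖n u u′)) (ℤₚ.∣⊖∣-≤ u≤)) d∣) e
  ... | inj₂ u≥ = sym (quot-injective-≤ d u′ u 0<d u≥ (subst (d ∣_) (trans (cong ∣_∣ (ℤₚ.m-n≡m⊖n u u′))
          (trans (ℤₚ.∣m⊖n∣≡∣n⊖m∣ u u′) (ℤₚ.∣⊖∣-≤ u≥))) d∣) (sym e))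

open Rationals

-- Solutions in 𝓕(H) of one equation with integer coefficients.

module IntegralSolutions where

  open import Data.Integer as ℤ using (ℤ; +_; ∣_∣; 0ℤ)
  import Data.Integer.Divisibility.Signed as ℤDiv
  import Data.Integer.Properties as ℤₚ
  import Data.Integer.Solver as ℤSolver
  open import Data.Nat.Divisibility using (_∣_; divides; ∣⇒≤; m∣m*n)

  dot : ∀ {s} → Vec ℤ s → Vec ℚ s → ℚ
  dot [] [] = 0ℚ
  dot (e ∷ es) (x ∷ z) = ι e ℚ.* x ℚ.+ dot es z

  -- The condition that passes through the induction. `L` is the product of the moduli chosen so
  -- far; a solution of the equation itself starts with `L = 1` and the integer 0.
  IntegralAt : ∀ {s} → ℕ → Vec ℤ s → Vec ℚ s → Set
  IntegralAt L es z = Σ ℤ λ k → ι (+ L) ℚ.* dot es z ≡ ι k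

  private
    ∣⇒multiple : ∀ i b → b ∣ ∣ i ∣ → Σ ℤ λ q → i ≡ q ℤ.* + b
    ∣⇒multiple i b b∣ with ℤDiv.∣ᵤ⇒∣ {+ b} {i} b∣
    ... | ℤDiv.divides q eq = q , eq

  -- The denominator of `x` divides `e L d`, so `L d e x` is an integer, and subtracting it from `d`
  -- times the integer `k` leaves `L d` times the tail.
  integralAt-tail : ∀ {s} L d e (es : Vec ℤ s) x z → ↧ₙ x ∣ ∣ e ∣ ℕ.* L ℕ.* d →
    IntegralAt L (e ∷ es) (x ∷ z) → IntegralAt (L ℕ.* d) es z
  integralAt-tail L d e es x z b∣ (k , h) with ∣⇒multiple (e ℤ.* + L ℤ.* + d) (↧ₙ x)
    (subst (↧ₙ x ∣_) (sym (trans (ℤₚ.abs-* (e ℤ.* + L) (+ d)) (cong (ℕ._* d) (ℤₚ.abs-* e (+ L))))) b∣)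
  ... | q , eq = k ℤ.* + d ℤ.+ ℤ.- (q ℤ.* ↥ x) , (begin
      ι (+ (L ℕ.* d)) ℚ.* r
        ≡⟨ cong (ℚ._* r) (trans (cong ι (ℤₚ.pos-* L d)) (ι-* (+ L) (+ d))) ⟩
      l ℚ.* δ ℚ.* r
        ≡⟨ solve 5 (λ l δ r ε x → l :* δ :* r := l :* (ε :* x :+ r) :* δ :- (ε :* l :* δ) :* x) refl l δ r (ι e) x ⟩
      l ℚ.* (ι e ℚ.* x ℚ.+ r) ℚ.* δ ℚ.- ι e ℚ.* l ℚ.* δ ℚ.* x
        ≡⟨ cong₂ (λ s t → s ℚ.* δ ℚ.- t ℚ.* x) h (trans (cong (ℚ._* δ) (sym (ι-* e (+ L)))) (sym (ι-* (e ℤ.* + L) (+ d)))) ⟩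
      ι k ℚ.* δ ℚ.- ι (e ℤ.* + L ℤ.* + d) ℚ.* x
        ≡⟨ cong (λ t → ι k ℚ.* δ ℚ.- t ℚ.* x) (trans (cong ι eq) (ι-* q (↧ x))) ⟩
      ι k ℚ.* δ ℚ.- ι q ℚ.* ι (↧ x) ℚ.* x
        ≡⟨ solve 5 (λ k δ q b x → k :* δ :- q :* b :* x := k :* δ :- q :* (x :* b)) refl (ι k) δ (ι q) (ι (↧ x)) x ⟩
      ι k ℚ.* δ ℚ.- ι q ℚ.* (x ℚ.* ι (↧ x))
        ≡⟨ cong (λ t → ι k ℚ.* δ ℚ.- ι q ℚ.* t) (*-↧ x) ⟩
      ι k ℚ.* δ ℚ.- ι q ℚ.* ι (↥ x)
        ≡⟨ cong₂ (λ s t → s ℚ.- t) (sym (ι-* k (+ d))) (sym (ι-* q (↥ x))) ⟩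
      ι (k ℤ.* + d) ℚ.- ι (q ℤ.* ↥ x)
        ≡⟨ cong (ι (k ℤ.* + d) ℚ.+_) (ι-neg (q ℤ.* ↥ x)) ⟨
      ι (k ℤ.* + d) ℚ.+ ι (ℤ.- (q ℤ.* ↥ x))
        ≡⟨ ι-+ (k ℤ.* + d) (ℤ.- (q ℤ.* ↥ x)) ⟨
      ι (k ℤ.* + d ℤ.+ ℤ.- (q ℤ.* ↥ x)) ∎)
    where
    open ≡-Reasoning
    open ℚSolver.+-*-Solver
    l δ r : ℚ
    l = ι (+ L)
    δ = ι (+ d)
    r = dot es z

  -- Subtracting the two conditions cancels the common tail and makes `e L (x - x′)` an integer; the
  -- common denominator then divides `e L` times the difference of the numerators. By minimality of
  -- the cofactor, this fixes the numerator modulo `d`.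
  integralAt-head : ∀ {s} L e (es : Vec ℤ s) x x′ z → ↧ₙ x′ ≡ ↧ₙ x →
    IntegralAt L (e ∷ es) (x ∷ z) → IntegralAt L (e ∷ es) (x′ ∷ z) →
    ↧ₙ x ∣ ∣ e ∣ ℕ.* L ℕ.* ∣ ↥ x ℤ.- ↥ x′ ∣
  integralAt-head L e es x x′ z b≡ (k , h) (k′ , h′) = divides ∣ k ℤ.- k′ ∣ (begin
      ∣ e ∣ ℕ.* L ℕ.* ∣ ↥ x ℤ.- ↥ x′ ∣     ≡⟨ cong (ℕ._* ∣ ↥ x ℤ.- ↥ x′ ∣) (ℤₚ.abs-* e (+ L)) ⟨
      ∣ e ℤ.* + L ∣ ℕ.* ∣ ↥ x ℤ.- ↥ x′ ∣   ≡⟨ ℤₚ.abs-* (e ℤ.* + L) (↥ x ℤ.- ↥ x′) ⟨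
      ∣ e ℤ.* + L ℤ.* (↥ x ℤ.- ↥ x′) ∣     ≡⟨ cong ∣_∣ (ι-injective {e ℤ.* + L ℤ.* (↥ x ℤ.- ↥ x′)} {(k ℤ.- k′) ℤ.* ↧ x} eqℚ) ⟩
      ∣ (k ℤ.- k′) ℤ.* ↧ x ∣               ≡⟨ ℤₚ.abs-* (k ℤ.- k′) (↧ x) ⟩
      ∣ k ℤ.- k′ ∣ ℕ.* ∣ ↧ x ∣             ≡⟨⟩
      ∣ k ℤ.- k′ ∣ ℕ.* ↧ₙ x                ∎)
    where
    open ≡-Reasoning
    open ℚSolver.+-*-Solver
    ι-- : ∀ a b → ι (a ℤ.- b) ≡ ι a ℚ.- ι b
    ι-- a b = trans (ι-+ a (ℤ.- b)) (cong (ι a ℚ.+_) (ι-neg b))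
    l r β : ℚ
    l = ι (+ L)
    r = dot es z
    β = ι (↧ x)
    eqℚ : ι (e ℤ.* + L ℤ.* (↥ x ℤ.- ↥ x′)) ≡ ι ((k ℤ.- k′) ℤ.* ↧ x)
    eqℚ = begin
      ι (e ℤ.* + L ℤ.* (↥ x ℤ.- ↥ x′))      ≡⟨ ι-* (e ℤ.* + L) (↥ x ℤ.- ↥ x′) ⟩
      ι (e ℤ.* + L) ℚ.* ι (↥ x ℤ.- ↥ x′)    ≡⟨ cong₂ ℚ._*_ (ι-* e (+ L)) (ι-- (↥ x) (↥ x′)) ⟩
      ι e ℚ.* l ℚ.* (ι (↥ x) ℚ.- ι (↥ x′))  ≡⟨ cong₂ (λ s t → ι e ℚ.* l ℚ.* (s ℚ.- t)) (*-↧ x) (*-↧ x′) ⟨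
      ι e ℚ.* l ℚ.* (x ℚ.* β ℚ.- x′ ℚ.* ι (↧ x′))
        ≡⟨ cong (λ t → ι e ℚ.* l ℚ.* (x ℚ.* β ℚ.- x′ ℚ.* ι t)) (cong +_ b≡) ⟩
      ι e ℚ.* l ℚ.* (x ℚ.* β ℚ.- x′ ℚ.* β)
        ≡⟨ solve 6 (λ ε l x x′ β r → ε :* l :* (x :* β :- x′ :* β)
             := (l :* (ε :* x :+ r) :- l :* (ε :* x′ :+ r)) :* β) refl (ι e) l x x′ β r ⟩
      (l ℚ.* (ι e ℚ.* x ℚ.+ r) ℚ.- l ℚ.* (ι e ℚ.* x′ ℚ.+ r)) ℚ.* β
        ≡⟨ cong₂ (λ s t → (s ℚ.- t) ℚ.* β) h h′ ⟩
      (ι k ℚ.- ι k′) ℚ.* β                  ≡⟨ cong (ℚ._* β) (ι-- k k′) ⟨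
      ι (k ℤ.- k′) ℚ.* β                    ≡⟨ ι-* (k ℤ.- k′) (↧ x) ⟨
      ι ((k ℤ.- k′) ℤ.* ↧ x)                ∎

  module _ (H D X : ℕ) (1≤H : 1 ≤ H) (3H≤X : 3 ℕ.* H ≤ X)
    (divisors : ∀ n → 0 < n → n ≤ X → Count (_∣ n) D) where

    -- `3 * H` counts the values of `window`, one `D` the modulus as a divisor of that value, the
    -- other `D` the denominator as a divisor of `E * d`. A coordinate with zero coefficient is
    -- free.
    weight₁ : ℤ → ℕ
    weight₁ e with e ℤ.≟ 0ℤ
    ... | yes _ = |𝓕| H
    ... | no _ = 3 ℕ.* H ℕ.* (D ℕ.* D)

    weight : ∀ {s} → Vec ℤ s → ℕ
    weight [] = 1
    weight (e ∷ es) = weight₁ e ℕ.* weight es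

    private
      instance
        H≢0 : NonZero H
        H≢0 = >-nonZero 1≤H

      Solution : ∀ {s} → ℕ → Vec ℤ s → Vec ℚ s → Set
      Solution L es z = (∀ i → InF H (lookup z i)) × IntegralAt L es z

      step-free : ∀ {s} L (es : Vec ℤ s) {N} → Count (Solution L es) N →
        Count (Solution L (0ℤ ∷ es)) (|𝓕| H ℕ.* N)
      step-free L es c = count-fibre ℚₚ._≟_ {R = λ z x → head z ≡ x} (count-𝓕 1≤H)
        (λ { (x ∷ z) (f , _) → x , f zero , refl })
        λ x _ → count-inj (Vecₚ.≡-dec ℚₚ._≟_) tail c
          (λ { (x ∷ z) ((f , k , h) , _) → f ∘ suc , k , trans (cong (ι (+ L) ℚ.*_)
            (trans (sym (ℚₚ.+-identityˡ (dot es z))) (cong (ℚ._+ dot es z) (sym (trans (cong (ℚ._* x) ι-0) (ℚₚ.*-zeroˡ x)))))) h })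
          λ { (x ∷ z) (.x ∷ .z) (_ , refl) (_ , refl) refl → refl }

      module Step (L : ℕ) (e : ℤ) (0<E : 0 < ∣ e ∣ ℕ.* L) where

        E : ℕ
        E = ∣ e ∣ ℕ.* L

        modulus : ℚ → ℕ
        modulus x = cofactor (↧ₙ x) E

        -- The integer nᵢ of the overview. The factor `modulus x` lets the modulus be found again
        -- among the divisors of this number instead of being counted on its own; the `suc` keeps
        -- the number positive, as the divisor bound requires.
        window : ℚ → ℕ
        window x = modulus x ℕ.* suc (quot (shift H (↥ x)) (modulus x))

        window≤ : ∀ x → InF H x → window x ≤ 3 ℕ.* H
        window≤ x (a≤ , b≤) with cofactor-spec (↧ₙ x) E (↧ₙ>0 x)
        ... | _ , d∣b , _ = begin
          d ℕ.* suc (quot u d)     ≡⟨ ℕₚ.*-suc d (quot u d) ⟩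
          d ℕ.+ d ℕ.* quot u d     ≤⟨ ℕₚ.+-mono-≤ (ℕₚ.≤-trans (∣⇒≤ {{>-nonZero (↧ₙ>0 x)}} d∣b) b≤)
                                       (ℕₚ.≤-trans (quot-≤ u d) (shift-≤ H (↥ x) a≤)) ⟩
          H ℕ.+ (H ℕ.+ H)          ≡⟨ cong (λ t → H ℕ.+ (H ℕ.+ t)) (ℕₚ.+-identityʳ H) ⟨
          3 ℕ.* H                  ∎
          where
          open ℕₚ.≤-Reasoning
          d u : ℕ
          d = modulus x
          u = shift H (↥ x)

        window>0 : ∀ x → 0 < window x
        window>0 x = ℕₚ.*-mono-≤ (proj₁ (cofactor-spec (↧ₙ x) E (↧ₙ>0 x))) (s≤s z≤n)

        -- Dividing the common window by the common modulus gives equal quotients, and integrality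
        -- gives equal residues, so the shifted numerators agree.
        head-unique : ∀ {s} (es : Vec ℤ s) x x′ z → InF H x → InF H x′ →
          IntegralAt L (e ∷ es) (x ∷ z) → IntegralAt L (e ∷ es) (x′ ∷ z) →
          ↧ₙ x′ ≡ ↧ₙ x → modulus x′ ≡ modulus x → window x ≡ window x′ → x ≡ x′
        head-unique es x x′ z (a≤ , _) (a′≤ , _) int int′ b≡ d≡ w≡
          with cofactor-spec (↧ₙ x) E (↧ₙ>0 x)
        ... | 0<d , _ , _ , minimal = ↥↧-injective
          (shift-injective H a≤ a′≤ (quot-injective d u u′ 0<d (subst (d ∣_) diff
              (minimal _ (integralAt-head L e es x x′ z b≡ int int′)))
            (ℕₚ.suc-injective (ℕₚ.*-cancelˡ-≡ _ _ d {{>-nonZero 0<d}}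
              (trans w≡ (cong (λ t → t ℕ.* suc (quot u′ t)) d≡))))))
          (sym b≡)
          where
          d u u′ : ℕ
          d = modulus x
          u = shift H (↥ x)
          u′ = shift H (↥ x′)
          diff : ∣ ↥ x ℤ.- ↥ x′ ∣ ≡ ∣ + u ℤ.- + u′ ∣
          diff = cong ∣_∣ (trans
            (solve 3 (λ a b h → a :- b := (a :+ h) :- (b :+ h)) refl (↥ x) (↥ x′) (+ H))
            (cong₂ ℤ._-_ (sym (shift-correct H (↥ x) a≤)) (sym (shift-correct H (↥ x′) a′≤))))
            where open ℤSolver.+-*-Solver

        -- Fixed in turn are the window, the modulus and the denominator; after that the tail
        -- determines the head. The new multiplier `L * d` depends on the fibre, so `N` has to serve
        -- all `d ≤ H` at once.
        step : ∀ {s} (es : Vec ℤ s) {N} → E ℕ.* H ≤ X →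
          (∀ d → 0 < d → d ≤ H → Count (Solution (L ℕ.* d) es) N) →
          Count (Solution L (e ∷ es)) (3 ℕ.* H ℕ.* (D ℕ.* (D ℕ.* N)))
        step {s} es {N} EH≤X c =
          count-fibre ℕₚ._≟_ {R = λ z n → window (head z) ≡ n} count-window
            (λ { (x ∷ z) (f , _) → window x , (window>0 x , window≤ x (f zero)) , refl })
          λ n (0<n , n≤) →
          count-fibre ℕₚ._≟_ {Q = λ d → d ∣ n × 0 < d × d ≤ H} {R = λ z d → modulus (head z) ≡ d}
            (count-⊆ {Q = _∣ n} {M = D} (λ _ → proj₁) ℕₚ.≤-refl (divisors n 0<n (ℕₚ.≤-trans n≤ 3H≤X)))
            (λ { (x ∷ z) ((f , _) , refl) → modulus x , (m∣m*n _ , modulus-ok x (f zero)) , refl })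
          λ d (_ , 0<d , d≤) →
          count-fibre ℕₚ._≟_ {R = λ z b → ↧ₙ head z ≡ b}
            (divisors (E ℕ.* d) (ℕₚ.*-mono-≤ 0<E 0<d) (ℕₚ.≤-trans (ℕₚ.*-monoʳ-≤ E d≤) EH≤X))
            (λ { (x ∷ z) ((_ , _) , refl) → ↧ₙ x ,
              proj₁ (proj₂ (proj₂ (cofactor-spec (↧ₙ x) E (↧ₙ>0 x)))) , refl })
          λ b b∣ →
          count-inj (Vecₚ.≡-dec ℚₚ._≟_) tail (c d 0<d d≤)
            (λ { (x ∷ z) ((((f , int) , _) , _) , refl) → f ∘ suc , integralAt-tail L d e es x z b∣ int })
            (λ { (x ∷ z) (x′ ∷ .z) ((((f , int) , refl) , refl) , refl) ((((f′ , int′) , w≡) , d≡) , b≡) refl →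
              cong (_∷ z) (head-unique es x x′ z (f zero) (f′ zero) int int′ b≡ d≡ (sym w≡)) })
          where
          modulus-ok : ∀ x → InF H x → (0 < modulus x) × (modulus x ≤ H)
          modulus-ok x (_ , b≤) with cofactor-spec (↧ₙ x) E (↧ₙ>0 x)
          ... | 0<d , d∣b , _ = 0<d , ℕₚ.≤-trans (∣⇒≤ {{>-nonZero (↧ₙ>0 x)}} d∣b) b≤
          count-window : Count (λ n → (0 < n) × (n ≤ 3 ℕ.* H)) (3 ℕ.* H)
          count-window = count-inj ℕₚ._≟_ ℕ.pred (count-< (3 ℕ.* H))
            (λ { (suc n) (_ , h) → h })
            λ { (suc n) (suc .n) _ _ refl → refl ; zero _ (() , _) ; (suc _) zero _ (() , _) }

    -- The size hypothesis reproduces itself: a nonzero coordinate replaces `L` by `L * d` with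
    -- `d ≤ H` and uses up one of the factors `H`. It keeps every `E * d` within the range of the
    -- divisor bound.
    count-integral : ∀ {s} L M (es : Vec ℤ s) → 0 < L → (∀ i → ∣ lookup es i ∣ ≤ M) →
      L ℕ.* H ℕ.^ s ℕ.* M ≤ X →
      Count (λ z → (∀ i → InF H (lookup z i)) × IntegralAt L es z) (weight es)
    count-integral L M [] 0<L es≤ small = count-≤1 λ { [] [] _ _ → refl }
    count-integral {suc s} L M (e ∷ es) 0<L es≤ small with e ℤ.≟ 0ℤ
    ... | yes refl = step-free L es (count-integral L M es 0<L (es≤ ∘ suc)
          (ℕₚ.≤-trans (ℕₚ.*-monoˡ-≤ M (ℕₚ.*-monoʳ-≤ L (ℕₚ.m≤n*m (H ℕ.^ s) H))) small))
    ... | no e≢0 = subst (Count _)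
            (solve 3 (λ h d w → h :* (d :* (d :* w)) := h :* (d :* d) :* w) refl (3 ℕ.* H) D (weight es))
            (step es EH≤X λ d 0<d d≤ → count-integral (L ℕ.* d) M es (ℕₚ.*-mono-≤ 0<L 0<d) (es≤ ∘ suc)
              (ℕₚ.≤-trans (ℕₚ.*-monoˡ-≤ M (begin
                L ℕ.* d ℕ.* H ℕ.^ s    ≤⟨ ℕₚ.*-monoˡ-≤ (H ℕ.^ s) (ℕₚ.*-monoʳ-≤ L d≤) ⟩
                L ℕ.* H ℕ.* H ℕ.^ s    ≡⟨ ℕₚ.*-assoc L H (H ℕ.^ s) ⟩
                L ℕ.* H ℕ.^ suc s      ∎)) small))
      where
      open ℕSolver.+-*-Solver
      open ℕₚ.≤-Reasoning
      0<∣e∣ : 0 < ∣ e ∣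
      0<∣e∣ = ℕₚ.n≢0⇒n>0 (e≢0 ∘ ℤₚ.∣i∣≡0⇒i≡0)
      open Step L e (ℕₚ.*-mono-≤ 0<∣e∣ 0<L)
      EH≤X : ∣ e ∣ ℕ.* L ℕ.* H ≤ X
      EH≤X = begin
        ∣ e ∣ ℕ.* L ℕ.* H                ≤⟨ ℕₚ.*-monoˡ-≤ H (ℕₚ.*-monoˡ-≤ L (es≤ zero)) ⟩
        M ℕ.* L ℕ.* H                    ≤⟨ ℕₚ.m≤m*n (M ℕ.* L ℕ.* H) (H ℕ.^ s) {{ℕₚ.m^n≢0 H s}} ⟩
        M ℕ.* L ℕ.* H ℕ.* H ℕ.^ s        ≡⟨ solve 4 (λ m l h p → m :* l :* h :* p := l :* (h :* p) :* m) refl M L H (H ℕ.^ s) ⟩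
        L ℕ.* H ℕ.^ suc s ℕ.* M          ≤⟨ small ⟩
        X                                ∎

open IntegralSolutions

-- Heights of rational expressions, elimination and pivot columns.

module LinearAlgebra where

  open import Algebra.Bundles using (CommutativeRing)
  open import Algebra.Properties.Semiring.Sum (CommutativeRing.semiring ℚₚ.+-*-commutativeRing) public
    using (sum; sum-cong-≗; *-distribˡ-sum; *-distribʳ-sum)
  open import Data.Integer as ℤ using (ℤ; +_; -[1+_]; ∣_∣)
  import Data.Integer.Properties as ℤₚ
  open import Data.Nat.Coprimality as Coprime using (Coprime; coprime-divisor)
  open import Data.Nat.Divisibility using (_∣_; divides; ∣⇒≤)
  open import Data.Rational using (1/_; _+_; _*_; _-_; -_)
  open ℚSolver using (module +-*-Solver)

  InF-mono : ∀ {T U} x → T ≤ U → InF T x → InF U x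
  InF-mono x T≤U (a , b) = ℕₚ.≤-trans a T≤U , ℕₚ.≤-trans b T≤U

  private
    cross-multiply : ∀ q a b → q * ι (+ b) ≡ ι a → ∣ ↥ q ∣ ℕ.* b ≡ ∣ a ∣ ℕ.* ↧ₙ q
    cross-multiply q a b e = trans (sym (ℤₚ.abs-* (↥ q) (+ b)))
      (trans (cong ∣_∣ (ι-injective {↥ q ℤ.* + b} {a ℤ.* ↧ q} (begin
        ι (↥ q ℤ.* + b)          ≡⟨ ι-* (↥ q) (+ b) ⟩
        ι (↥ q) * ι (+ b)        ≡⟨ cong (_* ι (+ b)) (*-↧ q) ⟨
        q * ι (↧ q) * ι (+ b)    ≡⟨ solve 3 (λ q d b → q :* d :* b := q :* b :* d) refl q (ι (↧ q)) (ι (+ b)) ⟩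
        q * ι (+ b) * ι (↧ q)    ≡⟨ cong (_* ι (↧ q)) e ⟩
        ι a * ι (↧ q)            ≡⟨ ι-* a (↧ q) ⟨
        ι (a ℤ.* ↧ q)            ∎))) (ℤₚ.abs-* a (↧ q)))
      where
      open ≡-Reasoning
      open +-*-Solver

    coprime-↧↥ : ∀ q → Coprime (↧ₙ q) ∣ ↥ q ∣
    coprime-↧↥ (mkℚ _ _ cop) = Coprime.sym (Coprime.recompute cop)

    reduced-≤ : ∀ {n d a b} → 0 < b → 0 < d → Coprime d n → n ℕ.* b ≡ a ℕ.* d → (n ≤ a) × (d ≤ b)
    reduced-≤ {n} {d} {a} {b} 0<b 0<d cop e with coprime-divisor cop (divides a e)
    ... | d∣b@(divides k b≡) = numerator-≤ k b≡ , ∣⇒≤ {{>-nonZero 0<b}} d∣b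
      where
      numerator-≤ : ∀ k → b ≡ k ℕ.* d → n ≤ a
      numerator-≤ zero b≡0 = ⊥-elim (ℕₚ.<⇒≢ 0<b (sym b≡0))
      numerator-≤ k@(suc _) b≡ = ℕₚ.≤-trans (ℕₚ.m≤m*n n k)
        (ℕₚ.≤-reflexive (ℕₚ.*-cancelʳ-≡ (n ℕ.* k) a d {{>-nonZero 0<d}}
          (trans (ℕₚ.*-assoc n k d) (trans (cong (n ℕ.*_) (sym b≡)) e))))

  -- Lowest terms minimise numerator and denominator at once, so any fraction representing `q`
  -- bounds its height and no gcd has to be computed.
  InF-fraction : ∀ {T} q a b → 0 < b → q * ι (+ b) ≡ ι a → ∣ a ∣ ≤ T → b ≤ T → InF T q
  InF-fraction q a b 0<b e a≤ b≤ =
    ℕₚ.≤-trans (proj₁ min) a≤ , ℕₚ.≤-trans (proj₂ min) b≤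
    where
    min : (∣ ↥ q ∣ ≤ ∣ a ∣) × (↧ₙ q ≤ b)
    min = reduced-≤ 0<b (↧ₙ>0 q) (coprime-↧↥ q) (cross-multiply q a b e)

  ι-↧* : ∀ x y → ι (+ (↧ₙ x ℕ.* ↧ₙ y)) ≡ ι (↧ x) * ι (↧ y)
  ι-↧* x y = trans (cong ι (ℤₚ.pos-* (↧ₙ x) (↧ₙ y))) (ι-* (↧ x) (↧ y))

  InF-* : ∀ {T U} x y → InF T x → InF U y → InF (T ℕ.* U) (x * y)
  InF-* {T} {U} x y (a , b) (c , d) = InF-fraction (x * y) (↥ x ℤ.* ↥ y) (↧ₙ x ℕ.* ↧ₙ y)
    (ℕₚ.*-mono-≤ (↧ₙ>0 x) (↧ₙ>0 y)) (begin
      x * y * ι (+ (↧ₙ x ℕ.* ↧ₙ y))      ≡⟨ cong (x * y *_) (ι-↧* x y) ⟩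
      x * y * (ι (↧ x) * ι (↧ y))        ≡⟨ solve 4 (λ x y d e → x :* y :* (d :* e) := x :* d :* (y :* e)) refl x y (ι (↧ x)) (ι (↧ y)) ⟩
      x * ι (↧ x) * (y * ι (↧ y))        ≡⟨ cong₂ _*_ (*-↧ x) (*-↧ y) ⟩
      ι (↥ x) * ι (↥ y)                  ≡⟨ ι-* (↥ x) (↥ y) ⟨
      ι (↥ x ℤ.* ↥ y)                    ∎)
    (ℕₚ.≤-trans (ℕₚ.≤-reflexive (ℤₚ.abs-* (↥ x) (↥ y))) (ℕₚ.*-mono-≤ a c)) (ℕₚ.*-mono-≤ b d)
    where
    open ≡-Reasoning
    open +-*-Solver

  InF-+ : ∀ {T U} x y → InF T x → InF U y → InF (2 ℕ.* (T ℕ.* U)) (x + y)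
  InF-+ {T} {U} x y (a , b) (c , d) = InF-fraction (x + y) num (↧ₙ x ℕ.* ↧ₙ y)
      (ℕₚ.*-mono-≤ (↧ₙ>0 x) (↧ₙ>0 y)) value num≤
      (ℕₚ.≤-trans (ℕₚ.*-mono-≤ b d) (ℕₚ.m≤m+n (T ℕ.* U) (T ℕ.* U ℕ.+ 0)))
    where
    num : ℤ
    num = ↥ x ℤ.* ↧ y ℤ.+ ↥ y ℤ.* ↧ x
    value : (x + y) * ι (+ (↧ₙ x ℕ.* ↧ₙ y)) ≡ ι num
    value = begin
      (x + y) * ι (+ (↧ₙ x ℕ.* ↧ₙ y))    ≡⟨ cong ((x + y) *_) (ι-↧* x y) ⟩
      (x + y) * (ι (↧ x) * ι (↧ y))      ≡⟨ solve 4 (λ x y d e → (x :+ y) :* (d :* e) := x :* d :* e :+ y :* e :* d) refl x y (ι (↧ x)) (ι (↧ y)) ⟩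
      x * ι (↧ x) * ι (↧ y) + y * ι (↧ y) * ι (↧ x)
                                         ≡⟨ cong₂ (λ s t → s * ι (↧ y) + t * ι (↧ x)) (*-↧ x) (*-↧ y) ⟩
      ι (↥ x) * ι (↧ y) + ι (↥ y) * ι (↧ x)
                                         ≡⟨ cong₂ _+_ (ι-* (↥ x) (↧ y)) (ι-* (↥ y) (↧ x)) ⟨
      ι (↥ x ℤ.* ↧ y) + ι (↥ y ℤ.* ↧ x)  ≡⟨ ι-+ (↥ x ℤ.* ↧ y) (↥ y ℤ.* ↧ x) ⟨
      ι num                              ∎
      where
      open ≡-Reasoning
      open +-*-Solver
    num≤ : ∣ num ∣ ≤ 2 ℕ.* (T ℕ.* U)
    num≤ = begin
      ∣ num ∣                                 ≤⟨ ℤₚ.∣i+j∣≤∣i∣+∣j∣ (↥ x ℤ.* ↧ y) (↥ y ℤ.* ↧ x) ⟩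
      ∣ ↥ x ℤ.* ↧ y ∣ ℕ.+ ∣ ↥ y ℤ.* ↧ x ∣     ≡⟨ cong₂ ℕ._+_ (ℤₚ.abs-* (↥ x) (↧ y)) (ℤₚ.abs-* (↥ y) (↧ x)) ⟩
      ∣ ↥ x ∣ ℕ.* ↧ₙ y ℕ.+ ∣ ↥ y ∣ ℕ.* ↧ₙ x   ≤⟨ ℕₚ.+-mono-≤ (ℕₚ.*-mono-≤ a d) (ℕₚ.*-mono-≤ c b) ⟩
      T ℕ.* U ℕ.+ U ℕ.* T                     ≡⟨ cong (λ t → T ℕ.* U ℕ.+ t) (trans (ℕₚ.*-comm U T) (sym (ℕₚ.+-identityʳ (T ℕ.* U)))) ⟩
      2 ℕ.* (T ℕ.* U)                         ∎
      where open ℕₚ.≤-Reasoning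

  InF-neg : ∀ {T} x → InF T x → InF T (- x)
  InF-neg (mkℚ (+ zero) _ _) p = p
  InF-neg (mkℚ (+ suc _) _ _) p = p
  InF-neg (mkℚ -[1+ _ ] _ _) p = p

  InF-0 : ∀ {T} → 1 ≤ T → InF T 0ℚ
  InF-0 h = z≤n , h

  -- Junk value: inv 0ℚ = 0ℚ.
  inv : ℚ → ℚ
  inv (mkℚ (+ zero) _ _) = 0ℚ
  inv x@(mkℚ (+ suc _) _ _) = 1/ x
  inv x@(mkℚ -[1+ _ ] _ _) = 1/ x

  InF-inv : ∀ {T} x → 1 ≤ T → InF T x → InF T (inv x)
  InF-inv (mkℚ (+ zero) _ _) h _ = InF-0 h
  InF-inv (mkℚ (+ suc _) _ _) _ (a , b) = b , a
  InF-inv (mkℚ -[1+ _ ] _ _) _ (a , b) = b , a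

  *-inv : ∀ x → x ≢ 0ℚ → x * inv x ≡ 1ℚ
  *-inv x@(mkℚ (+ zero) _ _) x≢0 = ⊥-elim (x≢0 (ℚₚ.↥p≡0⇒p≡0 x refl))
  *-inv x@(mkℚ (+ suc _) _ _) _ = ℚₚ.*-inverseʳ x
  *-inv x@(mkℚ -[1+ _ ] _ _) _ = ℚₚ.*-inverseʳ x

  -- Each addition multiplies heights and doubles; as `2 ≤ T`, the doubling counts as another factor
  -- `T`. Hence two powers per term.
  InF-sum : ∀ {T r} (f : Fin r → ℚ) → 2 ≤ T → (∀ i → InF T (f i)) → InF (T ℕ.^ (2 ℕ.* r)) (sum f)
  InF-sum {T} {zero} f _ _ = InF-0 (s≤s z≤n)
  InF-sum {T} {suc r} f 2≤T h = InF-mono (sum f) (begin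
      2 ℕ.* (T ℕ.* T ℕ.^ (2 ℕ.* r))     ≤⟨ ℕₚ.*-monoˡ-≤ (T ℕ.* T ℕ.^ (2 ℕ.* r)) 2≤T ⟩
      T ℕ.^ (2 ℕ.+ 2 ℕ.* r)             ≡⟨ cong (T ℕ.^_) (ℕₚ.*-suc 2 r) ⟨
      T ℕ.^ (2 ℕ.* suc r)               ∎)
    (InF-+ (f zero) (sum (f ∘ suc)) (h zero) (InF-sum (f ∘ suc) 2≤T (h ∘ suc)))
    where open ℕₚ.≤-Reasoning

  sum-- : ∀ {n} (f g : Fin n → ℚ) → sum (λ i → f i - g i) ≡ sum f - sum g
  sum-- {zero} f g = refl
  sum-- {suc n} f g = trans (cong (λ t → f zero - g zero + t) (sum-- (f ∘ suc) (g ∘ suc)))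
    (solve 4 (λ a b c d → a :- b :+ (c :- d) := a :+ c :- (b :+ d)) refl (f zero) (g zero) (sum (f ∘ suc)) (sum (g ∘ suc)))
    where open +-*-Solver

  sum-0 : ∀ {n} (f : Fin n → ℚ) → (∀ i → f i ≡ 0ℚ) → sum f ≡ 0ℚ
  sum-0 {zero} f _ = refl
  sum-0 {suc n} f h = cong₂ _+_ (h zero) (sum-0 (f ∘ suc) (h ∘ suc))

  comb : ∀ {r n} → (Fin r → ℚ) → (Fin r → Fin n → ℚ) → Fin n → ℚ
  comb c v k = sum (λ i → c i * v i k)

  Independent : ∀ {r n} → (Fin r → Fin n → ℚ) → Set
  Independent v = ∀ c → (∀ k → comb c v k ≡ 0ℚ) → ∀ i → c i ≡ 0ℚ

  comb-sub : ∀ {r n} (c d : Fin r → ℚ) (v : Fin r → Fin n → ℚ) k →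
    comb (λ i → c i - d i) v k ≡ comb c v k - comb d v k
  comb-sub c d v k = trans
    (sum-cong-≗ λ i → solve 3 (λ c d v → (c :- d) :* v := c :* v :- d :* v) refl (c i) (d i) (v i k))
    (sum-- (λ i → c i * v i k) (λ i → d i * v i k))
    where open +-*-Solver

  comb-unique : ∀ {r n} {v : Fin r → Fin n → ℚ} → Independent v → ∀ c d →
    (∀ k → comb c v k ≡ comb d v k) → ∀ i → c i ≡ d i
  comb-unique {v = v} ind c d h i = begin
    c i               ≡⟨ solve 2 (λ c d → c := (c :- d) :+ d) refl (c i) (d i) ⟩
    c i - d i + d i   ≡⟨ cong (_+ d i) (ind (λ i → c i - d i) (λ k → trans (comb-sub c d v k)
                           (trans (cong (_- comb d v k) (h k)) (ℚₚ.+-inverseʳ (comb d v k)))) i) ⟩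
    0ℚ + d i          ≡⟨ ℚₚ.+-identityˡ (d i) ⟩
    d i               ∎
    where
    open ≡-Reasoning
    open +-*-Solver

  module _ {r n : ℕ} (v : Fin (suc r) → Fin n → ℚ) (j : Fin n) (vj≢0 : v zero j ≢ 0ℚ) where

    private
      p : ℚ
      p = inv (v zero j)

    eliminate : Fin r → Fin n → ℚ
    eliminate i k = v (suc i) k - v (suc i) j * p * v zero k

    eliminate-pivot : ∀ i → eliminate i j ≡ 0ℚ
    eliminate-pivot i = begin
      x - x * p * q     ≡⟨ solve 3 (λ x p q → x :- x :* p :* q := x :- x :* (q :* p)) refl x p q ⟩
      x - x * (q * p)   ≡⟨ cong (λ t → x - x * t) (*-inv q vj≢0) ⟩
      x - x * 1ℚ        ≡⟨ cong (λ t → x - t) (ℚₚ.*-identityʳ x) ⟩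
      x - x             ≡⟨ ℚₚ.+-inverseʳ x ⟩
      0ℚ                ∎
      where
      open ≡-Reasoning
      open +-*-Solver
      x q : ℚ
      x = v (suc i) j
      q = v zero j

    -- The eliminated rows vanish in column `j`, so the coefficient of the pivot row can be read off
    -- there, while the other coefficients stay the same. Pivots, coefficient heights and the count
    -- of spans all rest on this identity.
    comb-eliminate : ∀ c k → comb c v k ≡ comb c v j * p * v zero k + comb (c ∘ suc) eliminate k
    comb-eliminate c k = sym (begin
      (c₀ * q + S j) * p * y + comb (c ∘ suc) eliminate k
        ≡⟨ cong (λ t → (c₀ * q + S j) * p * y + t) tail-comb ⟩
      (c₀ * q + S j) * p * y + (S k - S j * (p * y))
        ≡⟨ solve 6 (λ c₀ q s p y t → (c₀ :* q :+ s) :* p :* y :+ (t :- s :* (p :* y)) := c₀ :* (q :* p) :* y :+ t)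
             refl c₀ q (S j) p y (S k) ⟩
      c₀ * (q * p) * y + S k   ≡⟨ cong (λ t → c₀ * t * y + S k) (*-inv q vj≢0) ⟩
      c₀ * 1ℚ * y + S k        ≡⟨ cong (λ t → t * y + S k) (ℚₚ.*-identityʳ c₀) ⟩
      c₀ * y + S k             ∎)
      where
      open ≡-Reasoning
      open +-*-Solver
      c₀ q y : ℚ
      c₀ = c zero
      q = v zero j
      y = v zero k
      S : Fin n → ℚ
      S = comb (c ∘ suc) (v ∘ suc)
      tail-comb : comb (c ∘ suc) eliminate k ≡ S k - S j * (p * y)
      tail-comb = begin
        comb (c ∘ suc) eliminate k
          ≡⟨ sum-cong-≗ (λ i → solve 5 (λ c x z p y → c :* (x :- z :* p :* y) := c :* x :- c :* z :* (p :* y))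
               refl (c (suc i)) (v (suc i) k) (v (suc i) j) p y) ⟩
        sum (λ i → c (suc i) * v (suc i) k - c (suc i) * v (suc i) j * (p * y))
          ≡⟨ sum-- (λ i → c (suc i) * v (suc i) k) (λ i → c (suc i) * v (suc i) j * (p * y)) ⟩
        S k - sum (λ i → c (suc i) * v (suc i) j * (p * y))
          ≡⟨ cong (λ t → S k - t) (*-distribʳ-sum (p * y) (λ i → c (suc i) * v (suc i) j)) ⟨
        S k - S j * (p * y) ∎

    eliminate-independent : Independent v → Independent eliminate
    eliminate-independent ind d h i = ind c (λ k → begin
        comb c v k                                    ≡⟨ comb-eliminate c k ⟩
        comb c v j * p * v zero k + comb d eliminate k ≡⟨ cong₂ (λ s t → s * p * v zero k + t) at-pivot (h k) ⟩
        0ℚ * p * v zero k + 0ℚ                        ≡⟨ solve 2 (λ p y → con 0ℚ :* p :* y :+ con 0ℚ := con 0ℚ) refl p (v zero k) ⟩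
        0ℚ                                            ∎) (suc i)
      where
      open ≡-Reasoning
      open +-*-Solver
      S : ℚ
      S = comb d (v ∘ suc) j
      c : Fin (suc r) → ℚ
      -- Chosen so that the combination vanishes in the pivot column, where the remaining rows
      -- contribute `S`.
      c zero = - (S * p)
      c (suc i) = d i
      at-pivot : comb c v j ≡ 0ℚ
      at-pivot = begin
        - (S * p) * v zero j + S     ≡⟨ solve 3 (λ s p q → (:- (s :* p)) :* q :+ s := s :- s :* (q :* p)) refl S p (v zero j) ⟩
        S - S * (v zero j * p)       ≡⟨ cong (λ t → S - S * t) (*-inv (v zero j) vj≢0) ⟩
        S - S * 1ℚ                   ≡⟨ cong (λ t → S - t) (ℚₚ.*-identityʳ S) ⟩
        S - S                        ≡⟨ ℚₚ.+-inverseʳ S ⟩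
        0ℚ                           ∎

  nonzero-entry : ∀ {r n} (v : Fin (suc r) → Fin n → ℚ) → Independent v → Σ (Fin n) λ j → v zero j ≢ 0ℚ
  nonzero-entry {r} {n} v ind with Finₚ.any? (λ j → ¬? (v zero j ℚₚ.≟ 0ℚ))
  ... | yes p = p
  ... | no none = ⊥-elim (1≢0 (ind unit (λ k → cong₂ _+_
        (trans (ℚₚ.*-identityˡ (v zero k)) (decidable-stable (v zero k ℚₚ.≟ 0ℚ) λ ne → none (k , ne)))
        (sum-0 (λ i → 0ℚ * v (suc i) k) λ i → ℚₚ.*-zeroˡ (v (suc i) k))) zero))
    where
    unit : Fin (suc r) → ℚ
    unit zero = 1ℚ
    unit (suc _) = 0ℚ
    1≢0 : 1ℚ ≢ 0ℚ
    1≢0 ()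

  module _ {r n : ℕ} (v : Fin (suc r) → Fin n → ℚ) (j : Fin n) (vj≢0 : v zero j ≢ 0ℚ) (π′ : Fin r → Fin n) where

    private
      p : ℚ
      p = inv (v zero j)

      v′ : Fin r → Fin n → ℚ
      v′ = eliminate v j vj≢0

    extend-pivots : Fin (suc r) → Fin n
    extend-pivots zero = j
    extend-pivots (suc t) = π′ t

    -- Vanishing at `j` removes the pivot row from `comb-eliminate`, so on the other columns only
    -- eliminated rows remain and `ind′` applies.
    extend-independent : Independent (λ i t → v′ i (π′ t)) → Independent (λ i t → v i (extend-pivots t))
    extend-independent ind′ c h = λ { zero → c₀≡0 ; (suc i) → tail≡0 i }
      where
      open ≡-Reasoning
      open +-*-Solver
      S : Fin r → ℚ
      S t = comb (c ∘ suc) v′ (π′ t)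
      tail≡0 : ∀ i → c (suc i) ≡ 0ℚ
      tail≡0 = ind′ (c ∘ suc) λ t → begin
        S t                                        ≡⟨ ℚₚ.+-identityˡ (S t) ⟨
        0ℚ + S t                                   ≡⟨ cong (_+ S t) (ℚₚ.*-zeroˡ (v zero (π′ t))) ⟨
        0ℚ * v zero (π′ t) + S t                   ≡⟨ cong (λ s → s * v zero (π′ t) + S t) (ℚₚ.*-zeroˡ p) ⟨
        0ℚ * p * v zero (π′ t) + S t               ≡⟨ cong (λ s → s * p * v zero (π′ t) + S t) (h zero) ⟨
        comb c v j * p * v zero (π′ t) + S t       ≡⟨ comb-eliminate v j vj≢0 c (π′ t) ⟨
        comb c v (π′ t)                            ≡⟨ h (suc t) ⟩
        0ℚ                                         ∎
      c₀q≡0 : c zero * v zero j ≡ 0ℚ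
      c₀q≡0 = begin
        c zero * v zero j            ≡⟨ ℚₚ.+-identityʳ (c zero * v zero j) ⟨
        c zero * v zero j + 0ℚ       ≡⟨ cong (λ t → c zero * v zero j + t) (sum-0 (λ i → c (suc i) * v (suc i) j)
                                          λ i → trans (cong (_* v (suc i) j) (tail≡0 i)) (ℚₚ.*-zeroˡ (v (suc i) j))) ⟨
        comb c v j                   ≡⟨ h zero ⟩
        0ℚ                           ∎
      c₀≡0 : c zero ≡ 0ℚ
      c₀≡0 = begin
        c zero                       ≡⟨ ℚₚ.*-identityʳ (c zero) ⟨
        c zero * 1ℚ                  ≡⟨ cong (c zero *_) (*-inv (v zero j) vj≢0) ⟨
        c zero * (v zero j * p)      ≡⟨ ℚₚ.*-assoc (c zero) (v zero j) p ⟨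
        c zero * v zero j * p        ≡⟨ cong (_* p) c₀q≡0 ⟩
        0ℚ * p                       ≡⟨ ℚₚ.*-zeroˡ p ⟩
        0ℚ                           ∎

    extend-nonzero : (∀ t → ¬ (∀ i → v′ i (π′ t) ≡ 0ℚ)) → ∀ t → ¬ (∀ i → v i (extend-pivots t) ≡ 0ℚ)
    extend-nonzero nz′ zero h = vj≢0 (h zero)
    extend-nonzero nz′ (suc t) h = nz′ t λ i → trans
      (cong₂ (λ s u → s - v (suc i) j * p * u) (h (suc i)) (h zero))
      (trans (cong (λ s → 0ℚ - s) (ℚₚ.*-zeroʳ (v (suc i) j * p))) (ℚₚ.+-inverseʳ 0ℚ))

    -- An eliminated column vanishes, whereas later pivot columns do not.
    extend-injective : (∀ t → ¬ (∀ i → v′ i (π′ t) ≡ 0ℚ)) → Injective _≡_ _≡_ π′ → Injective _≡_ _≡_ extend-pivots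
    extend-injective nz′ inj = go
      where
      j∉π′ : ∀ t → j ≢ π′ t
      j∉π′ t e = nz′ t λ i → subst (λ k → v′ i k ≡ 0ℚ) e (eliminate-pivot v j vj≢0 i)
      go : ∀ {s t} → extend-pivots s ≡ extend-pivots t → s ≡ t
      go {zero} {zero} _ = refl
      go {zero} {suc t} e = ⊥-elim (j∉π′ t e)
      go {suc s} {zero} e = ⊥-elim (j∉π′ s (sym e))
      go {suc s} {suc t} e = cong suc (inj e)

  -- The field `nonzero` is there for the induction: it separates the later pivot columns from the
  -- column just cleared, and so gives `injective`.
  record Pivots {r n} (v : Fin r → Fin n → ℚ) : Set where
    field
      column : Fin r → Fin n
      independent : Independent (λ i t → v i (column t))
      nonzero : ∀ t → ¬ (∀ i → v i (column t) ≡ 0ℚ)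
      injective : Injective _≡_ _≡_ column

  pivots : ∀ {r n} (v : Fin r → Fin n → ℚ) → Independent v → Pivots v
  pivots {zero} v ind = record
    { column = λ () ; independent = λ _ _ () ; nonzero = λ () ; injective = λ { {()} } }
  pivots {suc r} {n} v ind = record
    { column = extend-pivots v j vj≢0 P.column
    ; independent = extend-independent v j vj≢0 P.column P.independent
    ; nonzero = extend-nonzero v j vj≢0 P.column P.nonzero
    ; injective = extend-injective v j vj≢0 P.column P.nonzero P.injective
    }
    where
    j : Fin n
    j = proj₁ (nonzero-entry v ind)
    vj≢0 : v zero j ≢ 0ℚ
    vj≢0 = proj₂ (nonzero-entry v ind)
    module P = Pivots (pivots (eliminate v j vj≢0) (eliminate-independent v j vj≢0 ind))

  -- An entry after elimination has height at most `2 T^4 ≤ T ^ 5`, hence `5 * coefficient-height r`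
  -- for the later coefficients. The first is `(x j - S) * p`: `S` has `r` terms of height
  -- `T ^ (5 * coefficient-height r + 1)` at two powers each, and 3 pays for the subtraction and for
  -- `p`. The sum covers both.
  coefficient-height : ℕ → ℕ
  coefficient-height zero = 0
  coefficient-height (suc r) = 5 ℕ.* coefficient-height r ℕ.+
    (3 ℕ.+ (5 ℕ.* coefficient-height r ℕ.+ 1) ℕ.* (2 ℕ.* r))

  -- Eliminating in `x` along with the rows keeps the later coefficients and leaves a system with
  -- one row fewer; the first coefficient is then solved for in the pivot column.
  InF-coefficients : ∀ {r n T} (v : Fin r → Fin n → ℚ) (x : Fin n → ℚ) (c : Fin r → ℚ) → 2 ≤ T →
    Independent v → (∀ i k → InF T (v i k)) → (∀ k → InF T (x k)) → (∀ k → x k ≡ comb c v k) →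
    ∀ i → InF (T ℕ.^ coefficient-height r) (c i)
  InF-coefficients {suc r} {n} {T} v x c 2≤T ind hv hx eq = λ { zero → InF-mono (c zero) (ℕₚ.^-monoʳ-≤ T (ℕₚ.m≤n+m e₀ (5 ℕ.* K))) head-height
                     ; (suc i) → InF-mono (c (suc i)) (ℕₚ.^-monoʳ-≤ T (ℕₚ.m≤m+n (5 ℕ.* K) e₀)) (tail-height i) }
    where
    j : Fin n
    j = proj₁ (nonzero-entry v ind)
    vj≢0 : v zero j ≢ 0ℚ
    vj≢0 = proj₂ (nonzero-entry v ind)
    K e₀ : ℕ
    K = coefficient-height r
    e₀ = 3 ℕ.+ (5 ℕ.* K ℕ.+ 1) ℕ.* (2 ℕ.* r)
    instance
      T≢0 : NonZero T
      T≢0 = >-nonZero (ℕₚ.≤-trans (s≤s z≤n) 2≤T)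
    1≤T : 1 ≤ T
    1≤T = ℕₚ.≤-trans (s≤s z≤n) 2≤T
    p : ℚ
    p = inv (v zero j)
    hp : InF T p
    hp = InF-inv (v zero j) 1≤T (hv zero j)
    reduced : ∀ a b d → InF T a → InF T b → InF T d → InF (T ℕ.^ 5) (a - b * p * d)
    reduced a b d ha hb hd = InF-mono (a - b * p * d) (ℕₚ.≤-trans (ℕₚ.*-monoˡ-≤ _ 2≤T) (ℕₚ.≤-reflexive
        (solve 1 (λ t → t :* (t :* (t :* t :* t)) := t :^ 5) refl T)))
      (InF-+ a (- (b * p * d)) ha (InF-neg (b * p * d) (InF-* (b * p) d (InF-* b p hb hp) hd)))
      where open ℕSolver.+-*-Solver
    v′ : Fin r → Fin n → ℚ
    v′ = eliminate v j vj≢0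
    x′ : Fin n → ℚ
    x′ k = x k - x j * p * v zero k
    x′-comb : ∀ k → x′ k ≡ comb (c ∘ suc) v′ k
    x′-comb k = begin
      x k - x j * p * v zero k     ≡⟨ cong₂ (λ s t → s - t * p * v zero k) (eq k) (eq j) ⟩
      comb c v k - comb c v j * p * v zero k
                                   ≡⟨ cong (_- comb c v j * p * v zero k) (comb-eliminate v j vj≢0 c k) ⟩
      comb c v j * p * v zero k + comb (c ∘ suc) v′ k - comb c v j * p * v zero k
                                   ≡⟨ solve 2 (λ a b → a :+ b :- a := b) refl (comb c v j * p * v zero k) (comb (c ∘ suc) v′ k) ⟩
      comb (c ∘ suc) v′ k          ∎
      where
      open ≡-Reasoning
      open +-*-Solver
    tail-height : ∀ i → InF (T ℕ.^ (5 ℕ.* K)) (c (suc i))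
    tail-height i = InF-mono (c (suc i)) (ℕₚ.≤-reflexive (ℕₚ.^-*-assoc T 5 K))
      (InF-coefficients v′ x′ (c ∘ suc) (ℕₚ.≤-trans 2≤T (ℕₚ.m≤m*n T (T ℕ.^ 4) {{ℕₚ.m^n≢0 T 4}}))
        (eliminate-independent v j vj≢0 ind)
        (λ i k → reduced (v (suc i) k) (v (suc i) j) (v zero k) (hv (suc i) k) (hv (suc i) j) (hv zero k))
        (λ k → reduced (x k) (x j) (v zero k) (hx k) (hx j) (hv zero k)) x′-comb i)
    S : ℚ
    S = comb (c ∘ suc) (v ∘ suc) j
    U : ℕ
    U = T ℕ.^ (5 ℕ.* K ℕ.+ 1)
    T≤U : T ≤ U
    T≤U = ℕₚ.≤-trans (ℕₚ.≤-reflexive (sym (ℕₚ.^-identityʳ T))) (ℕₚ.^-monoʳ-≤ T (ℕₚ.m≤n+m 1 (5 ℕ.* K)))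
    S-height : InF (U ℕ.^ (2 ℕ.* r)) S
    S-height = InF-sum _ (ℕₚ.≤-trans 2≤T T≤U)
      λ i → InF-mono (c (suc i) * v (suc i) j) (ℕₚ.≤-reflexive (trans (cong (T ℕ.^ (5 ℕ.* K) ℕ.*_) (sym (ℕₚ.^-identityʳ T)))
                       (sym (ℕₚ.^-distribˡ-+-* T (5 ℕ.* K) 1))))
              (InF-* (c (suc i)) (v (suc i) j) (tail-height i) (hv (suc i) j))
    head-eq : c zero ≡ (x j - S) * p
    head-eq = sym (begin
      (x j - S) * p                          ≡⟨ cong (λ t → (t - S) * p) (eq j) ⟩
      (c zero * v zero j + S - S) * p        ≡⟨ solve 4 (λ c q s p → (c :* q :+ s :- s) :* p := c :* (q :* p)) refl (c zero) (v zero j) S p ⟩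
      c zero * (v zero j * p)                ≡⟨ cong (c zero *_) (*-inv (v zero j) vj≢0) ⟩
      c zero * 1ℚ                            ≡⟨ ℚₚ.*-identityʳ (c zero) ⟩
      c zero                                 ∎)
      where
      open ≡-Reasoning
      open +-*-Solver
    head-height : InF (T ℕ.^ e₀) (c zero)
    head-height = subst (InF (T ℕ.^ e₀)) (sym head-eq) (InF-mono ((x j - S) * p) (begin
        2 ℕ.* (T ℕ.* V) ℕ.* T             ≤⟨ ℕₚ.*-monoˡ-≤ T (ℕₚ.*-monoˡ-≤ (T ℕ.* V) 2≤T) ⟩
        T ℕ.* (T ℕ.* V) ℕ.* T             ≡⟨ solve 2 (λ t v → t :* (t :* v) :* t := t :* (t :* (t :* v))) refl T V ⟩
        T ℕ.* (T ℕ.* (T ℕ.* V))           ≡⟨ cong (λ w → T ℕ.* (T ℕ.* (T ℕ.* w))) (ℕₚ.^-*-assoc T (5 ℕ.* K ℕ.+ 1) (2 ℕ.* r)) ⟩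
        T ℕ.^ e₀                          ∎)
      (InF-* (x j - S) p (InF-+ (x j) (- S) (hx j) (InF-neg S S-height)) hp))
      where
      open ℕₚ.≤-Reasoning
      open ℕSolver.+-*-Solver
      V : ℕ
      V = U ℕ.^ (2 ℕ.* r)

open LinearAlgebra

-- Sparse combinations with values in 𝓕(H), and equations with rational coefficients.

module LinearEquations where

  open import Data.Integer as ℤ using (ℤ; +_; ∣_∣; 0ℤ)
  import Data.Integer.Properties as ℤₚ
  open import Data.Nat.Divisibility using (_∣_)
  open import Data.Rational using (_+_; _*_; _-_)
  open ℚSolver using (module +-*-Solver)

  lookup-ext : ∀ {A : Set} {n} (u v : Vec A n) → (∀ i → lookup u i ≡ lookup v i) → u ≡ v
  lookup-ext u v h = trans (sym (Vecₚ.tabulate∘lookup u)) (trans (Vecₚ.tabulate-cong h) (Vecₚ.tabulate∘lookup v))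

  isNonzero : ℚ → ℕ
  isNonzero q with q ℚₚ.≟ 0ℚ
  ... | yes _ = 0
  ... | no _ = 1

  isNonzero-0 : ∀ {q} → q ≡ 0ℚ → isNonzero q ≡ 0
  isNonzero-0 {q} e with q ℚₚ.≟ 0ℚ
  ... | yes _ = refl
  ... | no ne = ⊥-elim (ne e)

  isNonzero-1 : ∀ {q} → q ≢ 0ℚ → isNonzero q ≡ 1
  isNonzero-1 {q} ne with q ℚₚ.≟ 0ℚ
  ... | yes e = ⊥-elim (ne e)
  ... | no _ = refl

  support : ∀ {r} → (Fin r → ℚ) → ℕ
  support {zero} c = 0
  support {suc r} c = isNonzero (c zero) ℕ.+ support (c ∘ suc)

  support-cong : ∀ {r} {c d : Fin r → ℚ} → (∀ i → c i ≡ d i) → support c ≡ support d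
  support-cong {zero} _ = refl
  support-cong {suc r} h = cong₂ ℕ._+_ (cong isNonzero (h zero)) (support-cong (h ∘ suc))

  support-≤ : ∀ {r} (c : Fin r → ℚ) → support c ≤ r
  support-≤ {zero} c = z≤n
  support-≤ {suc r} c with c zero ℚₚ.≟ 0ℚ
  ... | yes _ = ℕₚ.m≤n⇒m≤1+n (support-≤ (c ∘ suc))
  ... | no _ = s≤s (support-≤ (c ∘ suc))

  support>0 : ∀ {r} (c : Fin r → ℚ) i → c i ≢ 0ℚ → 0 < support c
  support>0 c zero ne = ℕₚ.≤-trans (ℕₚ.≤-reflexive (sym (isNonzero-1 ne))) (ℕₚ.m≤m+n _ _)
  support>0 c (suc i) ne = ℕₚ.≤-trans (support>0 (c ∘ suc) i ne) (ℕₚ.m≤n+m _ (isNonzero (c zero)))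

  module _ {H : ℕ} (1≤H : 1 ≤ H) where

    private
      G : ℕ
      G = |𝓕| H
      1≤G : 1 ≤ G
      1≤G = ℕₚ.*-mono-≤ (ℕₚ.≤-trans 1≤H (ℕₚ.m≤m+n H _)) (ℕₚ.≤-trans 1≤H (ℕₚ.m≤m+n H _))
      instance
        G≢0 : NonZero G
        G≢0 = >-nonZero 1≤G

      -- The translate `w` serves the induction: fixing one coordinate of `x` moves the span away
      -- from the origin.
      InAffineSpan : ∀ {r n} → (Fin n → ℚ) → (Fin r → Fin n → ℚ) → ℕ → Vec ℚ n → Set
      InAffineSpan {r} w v h x = (∀ k → InF H (lookup x k)) ×
        (Σ (Fin r → ℚ) λ c → support c ≤ h × (∀ k → lookup x k ≡ w k + comb c v k))

      span-pivot : ∀ {r n} (w : Fin n → ℚ) (v : Fin (suc r) → Fin n → ℚ) j (vj≢0 : v zero j ≢ 0ℚ) a c k →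
        a ≡ w j + comb c v j →
        w k + comb c v k ≡ w k + (a - w j) * inv (v zero j) * v zero k + comb (c ∘ suc) (eliminate v j vj≢0) k
      span-pivot w v j vj≢0 a c k e = begin
        w k + comb c v k                          ≡⟨ cong (λ s → w k + s) (comb-eliminate v j vj≢0 c k) ⟩
        w k + (comb c v j * p * y + rest)         ≡⟨ cong (λ s → w k + (s * p * y + rest)) (solve 2 (λ w c → c := w :+ c :- w) refl (w j) (comb c v j)) ⟩
        w k + ((w j + comb c v j - w j) * p * y + rest) ≡⟨ cong (λ s → w k + ((s - w j) * p * y + rest)) e ⟨
        w k + ((a - w j) * p * y + rest)          ≡⟨ ℚₚ.+-assoc (w k) ((a - w j) * p * y) rest ⟨
        w k + (a - w j) * p * y + rest            ∎
        where
        open ≡-Reasoning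
        open +-*-Solver
        p y rest : ℚ
        p = inv (v zero j)
        y = v zero k
        rest = comb (c ∘ suc) (eliminate v j vj≢0) k

    -- `2 ^ r` pays for deciding which coefficients vanish. Each of the at most `h` remaining rows
    -- costs one coordinate in 𝓕(H), whose value stands in for the coefficient. Vectors are counted,
    -- not coefficients, so `v` may be dependent.
    count-affine-span : ∀ {r n} h (w : Fin n → ℚ) (v : Fin r → Fin n → ℚ) →
      Count (InAffineSpan w v h) (2 ℕ.^ r ℕ.* G ℕ.^ h)

    private
      count-nonzero-head : ∀ {r n} h (w : Fin n → ℚ) (v : Fin (suc r) → Fin n → ℚ) →
        Count (λ x → (∀ k → InF H (lookup x k)) × (Σ (Fin (suc r) → ℚ) λ c →
          1 ℕ.+ support (c ∘ suc) ≤ h × (∀ k → lookup x k ≡ w k + comb c v k))) (2 ℕ.^ r ℕ.* G ℕ.^ h)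
      count-nonzero-head zero w v = count-⊆ (λ _ p → p) z≤n (count-∅ λ { _ (_ , _ , () , _) })
      count-nonzero-head {r} {n} (suc h) w v with Finₚ.any? (λ j → ¬? (v zero j ℚₚ.≟ 0ℚ))
      ... | no none = count-⊆
            (λ x (f , c , s , e) → f , c ∘ suc , s≤s⁻¹ s , λ k → trans (e k)
              (cong (λ t → w k + t) (trans (cong (_+ comb (c ∘ suc) (v ∘ suc) k) (trans (cong (c zero *_)
                (decidable-stable (v zero k ℚₚ.≟ 0ℚ) λ ne → none (k , ne))) (ℚₚ.*-zeroʳ (c zero))))
                (ℚₚ.+-identityˡ (comb (c ∘ suc) (v ∘ suc) k)))))
            (ℕₚ.*-monoʳ-≤ (2 ℕ.^ r) (ℕₚ.m≤n*m (G ℕ.^ h) G))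
            (count-affine-span h w (v ∘ suc))
      -- The value of `x` at `j` fixes the multiple of the pivot row. Elimination does not touch
      -- `c ∘ suc`, so its support bound carries over.
      ... | yes (j , vj≢0) = subst (Count _)
            (solve 3 (λ g t p → g :* (t :* p) := t :* (g :* p)) refl G (2 ℕ.^ r) (G ℕ.^ h))
            (count-fibre ℚₚ._≟_ {R = λ x a → lookup x j ≡ a} (count-𝓕 1≤H)
              (λ x (f , _) → lookup x j , f j , refl)
              λ a _ → count-⊆
                (λ { x ((f , c , s , e) , xj≡a) → f , c ∘ suc , s≤s⁻¹ s , λ k → trans (e k)
                  (span-pivot w v j vj≢0 a c k (trans (sym xj≡a) (e j))) })
                ℕₚ.≤-refl
                (count-affine-span h (λ k → w k + (a - w j) * inv (v zero j) * v zero k) (eliminate v j vj≢0)))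
        where open ℕSolver.+-*-Solver

    count-affine-span {zero} h w v = count-⊆ (λ _ p → p) (ℕₚ.*-mono-≤ (ℕₚ.≤-refl {1}) (ℕₚ.m^n>0 G h))
      (count-≤1 λ x y (_ , _ , _ , e) (_ , _ , _ , e′) → lookup-ext x y λ k → trans (e k) (sym (e′ k)))
    count-affine-span {suc r} {n} h w v = subst (Count _)
        (solve 2 (λ t g → t :* g :+ t :* g := con 2 :* t :* g) refl (2 ℕ.^ r) (G ℕ.^ h))
        (count-⊎ split (count-affine-span h w (v ∘ suc)) (count-nonzero-head h w v))
      where
      open ℕSolver.+-*-Solver
      split : ∀ x → InAffineSpan w v h x → InAffineSpan w (v ∘ suc) h x ⊎
        ((∀ k → InF H (lookup x k)) × (Σ (Fin (suc r) → ℚ) λ c →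
          1 ℕ.+ support (c ∘ suc) ≤ h × (∀ k → lookup x k ≡ w k + comb c v k)))
      split x (f , c , s , e) = by-cases (c zero ℚₚ.≟ 0ℚ)
        where
        by-cases : _ → _
        by-cases (yes c₀≡0) = inj₁ (f , c ∘ suc , subst (λ t → t ℕ.+ support (c ∘ suc) ≤ h) (isNonzero-0 c₀≡0) s ,
          λ k → trans (e k) (cong (λ t → w k + t) (trans
            (cong (_+ comb (c ∘ suc) (v ∘ suc) k) (trans (cong (_* v zero k) c₀≡0) (ℚₚ.*-zeroˡ (v zero k))))
            (ℚₚ.+-identityˡ (comb (c ∘ suc) (v ∘ suc) k)))))
        by-cases (no c₀≢0) = inj₂ (f , c , subst (λ t → t ℕ.+ support (c ∘ suc) ≤ h) (isNonzero-1 c₀≢0) s , e)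

  clear-denominators : ∀ {s T} (c : Fin s → ℚ) → (∀ i → InF T (c i)) → Σ ℕ λ N → Σ (Vec ℤ s) λ e →
    (0 < N) × (N ≤ T ℕ.^ s) × (∀ i → ∣ lookup e i ∣ ≤ T ℕ.^ s) × (∀ i → ι (lookup e i) ≡ c i * ι (+ N))
  clear-denominators {zero} c _ = 1 , [] , s≤s z≤n , ℕₚ.≤-refl , (λ ()) , λ ()
  clear-denominators {suc s} {T} c hc = N′ ℕ.* ↧ₙ c₀ , ↥ c₀ ℤ.* + N′ ∷ Vec.map (ℤ._* ↧ c₀) e ,
      ℕₚ.*-mono-≤ N>0 (↧ₙ>0 c₀) ,
      ℕₚ.≤-trans (ℕₚ.*-mono-≤ N≤ (proj₂ (hc zero))) (ℕₚ.≤-reflexive (ℕₚ.*-comm (T ℕ.^ s) T)) ,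
      (λ { zero → ℕₚ.≤-trans (ℕₚ.≤-reflexive (ℤₚ.abs-* (↥ c₀) (+ N′))) (ℕₚ.*-mono-≤ (proj₁ (hc zero)) N≤)
         ; (suc i) → ℕₚ.≤-trans (ℕₚ.≤-reflexive (trans (cong ∣_∣ (Vecₚ.lookup-map i (ℤ._* ↧ c₀) e)) (ℤₚ.abs-* (lookup e i) (↧ c₀))))
             (ℕₚ.≤-trans (ℕₚ.*-mono-≤ (e≤ i) (proj₂ (hc zero))) (ℕₚ.≤-reflexive (ℕₚ.*-comm (T ℕ.^ s) T))) }) ,
      λ { zero → begin
            ι (↥ c₀ ℤ.* + N′)             ≡⟨ ι-* (↥ c₀) (+ N′) ⟩
            ι (↥ c₀) * ι (+ N′)           ≡⟨ cong (_* ι (+ N′)) (*-↧ c₀) ⟨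
            c₀ * ι (↧ c₀) * ι (+ N′)      ≡⟨ solve 3 (λ c d n → c :* d :* n := c :* (n :* d)) refl c₀ (ι (↧ c₀)) (ι (+ N′)) ⟩
            c₀ * (ι (+ N′) * ι (↧ c₀))    ≡⟨ cong (c₀ *_) N≡ ⟨
            c₀ * ι (+ (N′ ℕ.* ↧ₙ c₀))     ∎
        ; (suc i) → begin
            ι (lookup (Vec.map (ℤ._* ↧ c₀) e) i)   ≡⟨ cong ι (Vecₚ.lookup-map i (ℤ._* ↧ c₀) e) ⟩
            ι (lookup e i ℤ.* ↧ c₀)                ≡⟨ ι-* (lookup e i) (↧ c₀) ⟩
            ι (lookup e i) * ι (↧ c₀)              ≡⟨ cong (_* ι (↧ c₀)) (e≡ i) ⟩
            c (suc i) * ι (+ N′) * ι (↧ c₀)        ≡⟨ ℚₚ.*-assoc (c (suc i)) (ι (+ N′)) (ι (↧ c₀)) ⟩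
            c (suc i) * (ι (+ N′) * ι (↧ c₀))      ≡⟨ cong (c (suc i) *_) N≡ ⟨
            c (suc i) * ι (+ (N′ ℕ.* ↧ₙ c₀))       ∎ }
    where
    open ≡-Reasoning
    open +-*-Solver
    c₀ : ℚ
    c₀ = c zero
    ih = clear-denominators (c ∘ suc) (hc ∘ suc)
    N′ : ℕ
    N′ = proj₁ ih
    e : Vec ℤ s
    e = proj₁ (proj₂ ih)
    N>0 = proj₁ (proj₂ (proj₂ ih))
    N≤ = proj₁ (proj₂ (proj₂ (proj₂ ih)))
    e≤ = proj₁ (proj₂ (proj₂ (proj₂ (proj₂ ih))))
    e≡ = proj₂ (proj₂ (proj₂ (proj₂ (proj₂ ih))))
    N≡ : ι (+ (N′ ℕ.* ↧ₙ c₀)) ≡ ι (+ N′) * ι (↧ c₀)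
    N≡ = trans (cong ι (ℤₚ.pos-* N′ (↧ₙ c₀))) (ι-* (+ N′) (↧ c₀))

  dot-scaled : ∀ {s} (e : Vec ℤ s) (c : Fin s → ℚ) N → (∀ i → ι (lookup e i) ≡ c i * N) → ∀ z →
    dot e z ≡ N * sum (λ i → c i * lookup z i)
  dot-scaled [] c N _ [] = sym (ℚₚ.*-zeroʳ N)
  dot-scaled (e ∷ es) c N h (x ∷ z) = begin
    ι e * x + dot es z          ≡⟨ cong₂ (λ a b → a * x + b) (h zero) (dot-scaled es (c ∘ suc) N (h ∘ suc) z) ⟩
    c zero * N * x + N * S      ≡⟨ solve 4 (λ c n x s → c :* n :* x :+ n :* s := n :* (c :* x :+ s)) refl (c zero) N x S ⟩
    N * (c zero * x + S)        ∎
    where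
    open ≡-Reasoning
    open +-*-Solver
    S : ℚ
    S = sum (λ i → c (suc i) * lookup z i)

  module _ (H D X : ℕ) (1≤H : 1 ≤ H) (3H≤X : 3 ℕ.* H ≤ X)
    (divisors : ∀ n → 0 < n → n ≤ X → Count (_∣ n) D) where

    private
      G E : ℕ
      G = |𝓕| H
      E = 3 ℕ.* H ℕ.* (D ℕ.* D)
      wt : ∀ {s} → Vec ℤ s → ℕ
      wt = weight H D X 1≤H 3H≤X divisors

      weight-power : ∀ {s} (e : Vec ℤ s) (c : Fin s → ℚ) N → 0 < N → (∀ i → ι (lookup e i) ≡ c i * ι (+ N)) →
        wt e ≡ G ℕ.^ (s ℕ.∸ support c) ℕ.* E ℕ.^ support c
      weight-power [] c N _ _ = refl
      weight-power {suc s} (e ∷ es) c N 0<N h with e ℤ.≟ 0ℤ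
      ... | yes e≡0 = begin
            G ℕ.* wt es                            ≡⟨ cong (G ℕ.*_) (weight-power es (c ∘ suc) N 0<N (h ∘ suc)) ⟩
            G ℕ.* (G ℕ.^ (s ℕ.∸ σ) ℕ.* E ℕ.^ σ)    ≡⟨ ℕₚ.*-assoc G (G ℕ.^ (s ℕ.∸ σ)) (E ℕ.^ σ) ⟨
            G ℕ.^ suc (s ℕ.∸ σ) ℕ.* E ℕ.^ σ        ≡⟨ cong (λ t → G ℕ.^ t ℕ.* E ℕ.^ σ) (ℕₚ.+-∸-assoc 1 (support-≤ (c ∘ suc))) ⟨
            G ℕ.^ (suc s ℕ.∸ σ) ℕ.* E ℕ.^ σ        ≡⟨ cong (λ t → G ℕ.^ (suc s ℕ.∸ (t ℕ.+ σ)) ℕ.* E ℕ.^ (t ℕ.+ σ)) (isNonzero-0 c₀≡0) ⟨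
            G ℕ.^ (suc s ℕ.∸ support c) ℕ.* E ℕ.^ support c ∎
        where
        open ≡-Reasoning
        σ : ℕ
        σ = support (c ∘ suc)
        N≢0 : ι (+ N) ≢ 0ℚ
        N≢0 q = ℕₚ.<⇒≢ 0<N (sym (cong ∣_∣ (ι-injective {+ N} {0ℤ} (trans q (sym ι-0)))))
        c₀≡0 : c zero ≡ 0ℚ
        c₀≡0 = begin
          c zero                             ≡⟨ ℚₚ.*-identityʳ (c zero) ⟨
          c zero * 1ℚ                        ≡⟨ cong (c zero *_) (*-inv (ι (+ N)) N≢0) ⟨
          c zero * (ι (+ N) * inv (ι (+ N))) ≡⟨ ℚₚ.*-assoc (c zero) (ι (+ N)) (inv (ι (+ N))) ⟨
          c zero * ι (+ N) * inv (ι (+ N))   ≡⟨ cong (_* inv (ι (+ N))) (trans (sym (h zero)) (trans (cong ι e≡0) ι-0)) ⟩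
          0ℚ * inv (ι (+ N))                 ≡⟨ ℚₚ.*-zeroˡ (inv (ι (+ N))) ⟩
          0ℚ                                 ∎
      ... | no e≢0 = begin
            E ℕ.* wt es                            ≡⟨ cong (E ℕ.*_) (weight-power es (c ∘ suc) N 0<N (h ∘ suc)) ⟩
            E ℕ.* (G ℕ.^ (s ℕ.∸ σ) ℕ.* E ℕ.^ σ)    ≡⟨ solve 3 (λ e g p → e :* (g :* p) := g :* (e :* p)) refl E (G ℕ.^ (s ℕ.∸ σ)) (E ℕ.^ σ) ⟩
            G ℕ.^ (s ℕ.∸ σ) ℕ.* E ℕ.^ suc σ        ≡⟨ cong (λ t → G ℕ.^ (suc s ℕ.∸ (t ℕ.+ σ)) ℕ.* E ℕ.^ (t ℕ.+ σ)) (isNonzero-1 c₀≢0) ⟨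
            G ℕ.^ (suc s ℕ.∸ support c) ℕ.* E ℕ.^ support c ∎
        where
        open ≡-Reasoning
        open ℕSolver.+-*-Solver
        σ : ℕ
        σ = support (c ∘ suc)
        c₀≢0 : c zero ≢ 0ℚ
        c₀≢0 q = e≢0 (ι-injective {e} {0ℤ} (trans (h zero) (trans (cong (_* ι (+ N)) q)
          (trans (ℚₚ.*-zeroˡ (ι (+ N))) (sym ι-0)))))

    -- Clearing denominators multiplies all coefficients by one positive integer, which preserves
    -- the support and leaves integers of size at most `T ^ s`; the equation then enters as
    -- integrality with `L = 1`.
    count-equation : ∀ {s T} (c : Fin s → ℚ) → (∀ i → InF T (c i)) → H ℕ.^ s ℕ.* T ℕ.^ s ≤ X →
      Count (λ z → (∀ i → InF H (lookup z i)) × sum (λ i → c i * lookup z i) ≡ 0ℚ)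
        (G ℕ.^ (s ℕ.∸ support c) ℕ.* E ℕ.^ support c)
    count-equation {s} {T} c hc small = bound (clear-denominators c hc)
      where
      bound : _ → _
      bound (N , e , 0<N , _ , e≤ , e≡) = count-⊆
        (λ z (f , eq) → f , 0ℤ , trans (cong (ι (+ 1) *_) (trans (dot-scaled e c (ι (+ N)) e≡ z)
          (trans (cong (ι (+ N) *_) eq) (ℚₚ.*-zeroʳ (ι (+ N)))))) (trans (ℚₚ.*-zeroʳ (ι (+ 1))) (sym ι-0)))
        (ℕₚ.≤-reflexive (weight-power e c N 0<N e≡))
        (count-integral H D X 1≤H 3H≤X divisors 1 (T ℕ.^ s) e (s≤s z≤n) e≤
          (ℕₚ.≤-trans (ℕₚ.≤-reflexive (cong (ℕ._* T ℕ.^ s) (ℕₚ.*-identityˡ (H ℕ.^ s)))) small))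

open LinearEquations

-- From rank to coefficients with respect to a row basis.

module Rank where

  open import Data.Rational using (_+_; _*_; -_)
  open ℚSolver using (module +-*-Solver)

  entry : ∀ {m n} → Matrix m n → Fin m → Fin n → ℚ
  entry A i k = lookup (lookup A i) k

  lookup-linComb : ∀ {r n} (c : Vec ℚ r) (vs : Vec (Vec ℚ n) r) k →
    lookup (linComb c vs) k ≡ comb (lookup c) (entry vs) k
  lookup-linComb [] [] k = Vecₚ.lookup-replicate k 0ℚ
  lookup-linComb (c ∷ cs) (v ∷ vs) k = trans (Vecₚ.lookup-zipWith _+_ k (Vec.map (c *_) v) (linComb cs vs))
    (cong₂ _+_ (Vecₚ.lookup-map k (c *_) v) (lookup-linComb cs vs k))

  comb-cong : ∀ {r n} {c d : Fin r → ℚ} {v w : Fin r → Fin n → ℚ} k →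
    (∀ i → c i ≡ d i) → (∀ i → v i k ≡ w i k) → comb c v k ≡ comb d w k
  comb-cong k h h′ = sum-cong-≗ λ i → cong₂ _*_ (h i) (h′ i)

  module _ {m n : ℕ} (A : Matrix m n) where

    private
      entry-rowsAt : ∀ {r} (σ : Fin r → Fin m) i k → entry (rowsAt A σ) i k ≡ entry A (σ i) k
      entry-rowsAt σ i k = cong (λ t → lookup t k) (Vecₚ.lookup∘tabulate (λ i → lookup A (σ i)) i)

    linIndep⇒independent : ∀ {r} (σ : Fin r → Fin m) → LinIndep (rowsAt A σ) → Independent (entry A ∘ σ)
    linIndep⇒independent σ ind c h i = begin
        c i                                    ≡⟨ Vecₚ.lookup∘tabulate c i ⟨
        lookup (Vec.tabulate c) i              ≡⟨ cong (λ t → lookup t i) (ind (Vec.tabulate c) zero-comb) ⟩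
        lookup (Vec.replicate _ 0ℚ) i          ≡⟨ Vecₚ.lookup-replicate i 0ℚ ⟩
        0ℚ                                     ∎
      where
      open ≡-Reasoning
      zero-comb : linComb (Vec.tabulate c) (rowsAt A σ) ≡ Vec.replicate n 0ℚ
      zero-comb = lookup-ext _ _ λ k → trans (lookup-linComb (Vec.tabulate c) (rowsAt A σ) k)
        (trans (comb-cong {v = entry (rowsAt A σ)} {w = entry A ∘ σ} k (Vecₚ.lookup∘tabulate c) (λ i → entry-rowsAt σ i k))
          (trans (h k) (sym (Vecₚ.lookup-replicate k 0ℚ))))

    independent⇒linIndep : ∀ {r} (σ : Fin r → Fin m) → Independent (entry A ∘ σ) → LinIndep (rowsAt A σ)
    independent⇒linIndep σ ind c h = lookup-ext _ _ λ i → trans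
      (ind (lookup c) (λ k → trans (sym (trans (lookup-linComb c (rowsAt A σ) k)
          (comb-cong {c = lookup c} {v = entry (rowsAt A σ)} {w = entry A ∘ σ} k (λ _ → refl) (λ i → entry-rowsAt σ i k))))
        (trans (cong (λ t → lookup t k) h) (Vecₚ.lookup-replicate k 0ℚ))) i)
      (sym (Vecₚ.lookup-replicate i 0ℚ))

  ¬¬-∀ : ∀ {n} {P : Fin n → Set} → (∀ i → ¬ ¬ P i) → ¬ ¬ (∀ i → P i)
  ¬¬-∀ {zero} h k = k λ ()
  ¬¬-∀ {suc n} h k = h zero λ p → ¬¬-∀ (h ∘ suc) λ q → k λ { zero → p ; (suc i) → q i }

  dependency : ∀ {r n} {v : Fin r → Fin n → ℚ} → ¬ Independent v →
    ¬ ¬ (Σ (Fin r → ℚ) λ c → (∀ k → comb c v k ≡ 0ℚ) × (Σ (Fin r) λ i → c i ≢ 0ℚ))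
  dependency dep none = dep λ c h i → decidable-stable (c i ℚₚ.≟ 0ℚ) λ ne → none (c , h , i , ne)

  unit : ∀ {r} → Fin r → Fin r → ℚ
  unit zero zero = 1ℚ
  unit zero (suc _) = 0ℚ
  unit (suc _) zero = 0ℚ
  unit (suc t) (suc s) = unit t s

  comb-unit : ∀ {r n} t (v : Fin r → Fin n → ℚ) k → comb (unit t) v k ≡ v t k
  comb-unit zero v k = trans (cong₂ _+_ (ℚₚ.*-identityˡ (v zero k))
    (sum-0 (λ i → 0ℚ * v (suc i) k) λ i → ℚₚ.*-zeroˡ (v (suc i) k))) (ℚₚ.+-identityʳ (v zero k))
  comb-unit (suc t) v k = trans (cong₂ _+_ (ℚₚ.*-zeroˡ (v zero k)) (comb-unit t (v ∘ suc) k))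
    (ℚₚ.+-identityˡ (v (suc t) k))

  unit-nonzero : ∀ {r} (t : Fin r) → unit t t ≢ 0ℚ
  unit-nonzero zero ()
  unit-nonzero (suc t) e = unit-nonzero t e

  module _ {r n : ℕ} (v : Fin (suc r) → Fin n → ℚ) (c : Fin (suc r) → ℚ)
    (h : ∀ k → comb c v k ≡ 0ℚ) where

    solve-for-head : c zero ≢ 0ℚ → ∀ k → v zero k ≡ comb (λ t → - (inv (c zero)) * c (suc t)) (v ∘ suc) k
    solve-for-head c₀≢0 k = begin
      v zero k                       ≡⟨ ℚₚ.*-identityˡ (v zero k) ⟨
      1ℚ * v zero k                  ≡⟨ cong (_* v zero k) (*-inv (c zero) c₀≢0) ⟨
      c zero * q * v zero k          ≡⟨ solve 4 (λ c q x s → c :* q :* x := q :* (c :* x :+ s) :+ (:- q) :* s) refl (c zero) q (v zero k) S ⟩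
      q * comb c v k + (- q) * S     ≡⟨ cong (λ t → q * t + (- q) * S) (h k) ⟩
      q * 0ℚ + (- q) * S             ≡⟨ cong (_+ (- q) * S) (ℚₚ.*-zeroʳ q) ⟩
      0ℚ + (- q) * S                 ≡⟨ ℚₚ.+-identityˡ ((- q) * S) ⟩
      (- q) * S                      ≡⟨ *-distribˡ-sum (- q) (λ t → c (suc t) * v (suc t) k) ⟩
      sum (λ t → (- q) * (c (suc t) * v (suc t) k))
                                     ≡⟨ sum-cong-≗ (λ t → sym (ℚₚ.*-assoc (- q) (c (suc t)) (v (suc t) k))) ⟩
      comb (λ t → - q * c (suc t)) (v ∘ suc) k ∎
      where
      open ≡-Reasoning
      open +-*-Solver
      q S : ℚ
      q = inv (c zero)
      S = comb (c ∘ suc) (v ∘ suc) k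

    head-nonzero : Independent (v ∘ suc) → (Σ (Fin (suc r)) λ i → c i ≢ 0ℚ) → c zero ≢ 0ℚ
    head-nonzero ind (zero , ne) = ne
    head-nonzero ind (suc i , ne) c₀≡0 = ne (ind (c ∘ suc) (λ k → trans (sym (ℚₚ.+-identityˡ (comb (c ∘ suc) (v ∘ suc) k)))
      (trans (cong (_+ comb (c ∘ suc) (v ∘ suc) k) (sym (trans (cong (_* v zero k) c₀≡0) (ℚₚ.*-zeroˡ (v zero k))))) (h k))) i)

  -- The row indices are kept in a vector so that they can be compared.
  record RankFactorisation {m n : ℕ} (r : ℕ) (A : Matrix m n) : Set where
    field
      rows : Vec (Fin m) r
    row : Fin r → Fin m
    row = lookup rows
    field
      row-injective : Injective _≡_ _≡_ row
      row-independent : Independent (entry A ∘ row)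
      coefficient : Fin m → Fin r → ℚ
      factors : ∀ i k → entry A i k ≡ comb (coefficient i) (entry A ∘ row) k

    coefficient-row : ∀ t s → coefficient (row t) s ≡ unit t s
    coefficient-row t = comb-unique row-independent (coefficient (row t)) (unit t)
      λ k → trans (sym (factors (row t) k)) (sym (comb-unit t (entry A ∘ row) k))

  -- Adjoining a row outside the basis gives `r + 1` rows, which are dependent; independence of the
  -- basis makes the coefficient of the new row nonzero, so it can be solved for.
  hasRank⇒factorisation : ∀ {m n r} (A : Matrix m n) → HasRank A r → ¬ ¬ RankFactorisation r A
  hasRank⇒factorisation {m} {n} {r} A ((σ₀ , σ₀-inj , σ₀-ind) , dep) none =
    ¬¬-∀ combination λ l → none record
      { rows = Vec.tabulate σ₀ ; row-injective = λ {s} {t} e → σ₀-inj (trans (sym (σ≗ s)) (trans e (σ≗ t)))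
      ; row-independent = ind ; coefficient = λ i → proj₁ (l i) ; factors = λ i → proj₂ (l i) }
    where
    σ : Fin r → Fin m
    σ = lookup (Vec.tabulate σ₀)
    σ≗ : ∀ t → σ t ≡ σ₀ t
    σ≗ = Vecₚ.lookup∘tabulate σ₀
    ind : Independent (entry A ∘ σ)
    ind = linIndep⇒independent A σ (subst LinIndep (Vecₚ.tabulate-cong λ t → cong (lookup A) (sym (σ≗ t))) σ₀-ind)
    Combination : Fin m → Set
    Combination i = Σ (Fin r → ℚ) λ l → ∀ k → entry A i k ≡ comb l (entry A ∘ σ) k
    combination : ∀ i → ¬ ¬ Combination i
    combination i none′ = by-cases (Finₚ.any? (λ t → σ t Finₚ.≟ i))
      where
      τ : Fin (suc r) → Fin m
      τ zero = i
      τ (suc t) = σ t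
      by-cases : _ → ⊥
      -- For a row of the basis `τ` would repeat an index, and the rank hypothesis says nothing
      -- about it.
      by-cases (yes (t , refl)) = none′ (unit t , λ k → sym (comb-unit t (entry A ∘ σ) k))
      by-cases (no i∉σ) = dependency {v = entry A ∘ τ} (λ ind-τ → dep τ τ-inj (independent⇒linIndep A τ ind-τ))
        λ { (c , h , ne) → none′ ((λ t → - (inv (c zero)) * c (suc t)) ,
              solve-for-head (entry A ∘ τ) c h (head-nonzero (entry A ∘ τ) c h ind ne)) }
        where
        τ-inj : Injective _≡_ _≡_ τ
        τ-inj {zero} {zero} _ = refl
        τ-inj {zero} {suc t} e = ⊥-elim (i∉σ (t , sym e))
        τ-inj {suc s} {zero} e = ⊥-elim (i∉σ (s , e))
        τ-inj {suc s} {suc t} e = cong suc (σ₀-inj (trans (sym (σ≗ s)) (trans e (σ≗ t))))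

open Rank

-- Arithmetic of the exponents.

module Bounds where

  open import Data.Nat using (_+_; _*_; _^_; _∸_)
  open ℕSolver using (module +-*-Solver)
  open import Data.List using (filter; tabulate; _++_; allFin)
  import Data.List.Membership.Propositional.Properties as ∈ₚ
  import Data.List.Relation.Unary.Unique.Propositional.Properties as Uniqueₚ

  ∏-const : ∀ n N → ∏ {n} (λ _ → N) ≡ N ^ n
  ∏-const zero N = refl
  ∏-const (suc n) N = cong (N *_) (∏-const n N)

  oneIf : ∀ {P : Set} → Dec P → ℕ → ℕ
  oneIf (yes _) N = 1
  oneIf (no _) N = N

  ∏-oneIf : ∀ {X : Set} {P : X → Set} (P? : Decidable P) N {n} (f : Fin n → X) →
    ∏ (λ i → oneIf (P? (f i)) N) ≡ N ^ length (filter (¬? ∘ P?) (tabulate f))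
  ∏-oneIf P? N {zero} f = refl
  ∏-oneIf P? N {suc n} f with P? (f zero)
  ... | yes _ = trans (ℕₚ.*-identityˡ _) (∏-oneIf P? N (f ∘ suc))
  ... | no _ = cong (N *_) (∏-oneIf P? N (f ∘ suc))

  inImage? : ∀ {r m} (σ : Fin r → Fin m) → Decidable (λ i → Σ (Fin r) λ t → σ t ≡ i)
  inImage? σ i = Finₚ.any? λ t → σ t Finₚ.≟ i

  -- The indices outside the image, followed by the `r` distinct images, form a list without
  -- repetition in `Fin m`; so at most `m - r` factors differ from 1.
  ∏-outside-image : ∀ {r m} (σ : Fin r → Fin m) → Injective _≡_ _≡_ σ → ∀ N → 1 ≤ N →
    ∏ (λ i → oneIf (inImage? σ i) N) ≤ N ^ (m ∸ r)
  ∏-outside-image {r} {m} σ inj N 1≤N = ℕₚ.≤-trans (ℕₚ.≤-reflexive (∏-oneIf (inImage? σ) N id))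
      (ℕₚ.^-monoʳ-≤ N {{>-nonZero 1≤N}} (ℕₚ.m+n≤o⇒m≤o∸n (length outside) (ℕₚ.≤-trans (ℕₚ.≤-reflexive total)
        (count-Fin (λ _ → ⊤) (outside ++ image) unique (All.universal (λ _ → tt) _)))))
    where
    outside image : List (Fin m)
    outside = filter (¬? ∘ inImage? σ) (allFin m)
    image = List.map σ (allFin r)
    total : length outside + r ≡ length (outside ++ image)
    total = sym (trans (Listₚ.length-++ outside)
      (cong (length outside +_) (trans (Listₚ.length-map σ (allFin r)) (Listₚ.length-tabulate id))))
    unique = Uniqueₚ.++⁺ (Uniqueₚ.filter⁺ (¬? ∘ inImage? σ) (Uniqueₚ.allFin⁺ m)) (Uniqueₚ.map⁺ inj (Uniqueₚ.allFin⁺ r))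
      λ (i∈out , i∈im) → let (t , _ , i≡) = ∈ₚ.∈-map⁻ σ i∈im in
        proj₂ (∈ₚ.∈-filter⁻ (¬? ∘ inImage? σ) {xs = allFin m} i∈out) (t , sym i≡)

  argmax : ∀ {m} (f : Fin (suc m) → ℕ) → Σ (Fin (suc m)) λ i → ∀ j → f j ≤ f i
  argmax {zero} f = zero , λ { zero → ℕₚ.≤-refl }
  argmax {suc m} f with argmax (f ∘ suc)
  ... | i , max with f zero ≤? f (suc i)
  ...   | yes le = suc i , λ { zero → le ; (suc j) → max j }
  ...   | no gt = zero , λ { zero → ℕₚ.≤-refl ; (suc j) → ℕₚ.≤-trans (max j) (ℕₚ.<⇒≤ (ℕₚ.≰⇒> gt)) }

  -- Linear in h, with slope 2(m - r) - (n - r): the maximum over 1 ≤ h ≤ r is at h = r or at h = 1,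
  -- according to the two cases of expo.
  exponent : ℕ → ℕ → ℕ → ℕ → ℕ
  exponent m n r h = 2 * (r * r) + 2 * h * (m ∸ r) + (2 * (r ∸ h) + suc h) * (n ∸ r)

  private
    -- Writing `m = r + a`, `n = r + b`, `r = h + g` removes all truncated subtractions. The two
    -- sides then differ by `g (2a - b)`, which is zero at `h = r`.
    exponent-≤-large : ∀ a b h g → b ≤ 2 * a → let r = h + g in
      2 * (r * r) + 2 * h * a + (2 * g + suc h) * b + (r * r + r) ≤
      2 * (r + a) * r + (r + b) * r + (r + b)
    exponent-≤-large a b h g b≤2a = begin
      2 * (r * r) + 2 * h * a + (2 * g + suc h) * b + (r * r + r)
        ≡⟨ solve 4 (λ a b h g → let r = h :+ g in
             con 2 :* (r :* r) :+ con 2 :* h :* a :+ (con 2 :* g :+ (con 1 :+ h)) :* b :+ (r :* r :+ r)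
             := con 3 :* (r :* r) :+ r :+ con 2 :* h :* a :+ g :* b :+ h :* b :+ b :+ g :* b) refl a b h g ⟩
      base + g * b
        ≤⟨ ℕₚ.+-monoʳ-≤ base (ℕₚ.*-monoʳ-≤ g b≤2a) ⟩
      base + g * (2 * a)
        ≡⟨ solve 4 (λ a b h g → let r = h :+ g in
             con 3 :* (r :* r) :+ r :+ con 2 :* h :* a :+ g :* b :+ h :* b :+ b :+ g :* (con 2 :* a)
             := con 2 :* (r :+ a) :* r :+ (r :+ b) :* r :+ (r :+ b)) refl a b h g ⟩
      2 * (r + a) * r + (r + b) * r + (r + b) ∎
      where
      open ℕₚ.≤-Reasoning
      open +-*-Solver
      r base : ℕ
      r = h + g
      base = 3 * (r * r) + r + 2 * h * a + g * b + h * b + b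

    -- Here `suc h` is the number of terms, and the two sides differ by `h (b - 2a)`, which is zero
    -- for a single term.
    exponent-≤-small : ∀ a b h g → 2 * a ≤ b → let r = suc h + g in
      2 * (r * r) + 2 * suc h * a + (2 * g + suc (suc h)) * b + 2 * r ≤ 2 * (r + b) * r + 2 * (r + a)
    exponent-≤-small a b h g 2a≤b = begin
      2 * (r * r) + 2 * suc h * a + (2 * g + suc (suc h)) * b + 2 * r
        ≡⟨ solve 4 (λ a b h g → let r = con 1 :+ h :+ g in
             con 2 :* (r :* r) :+ con 2 :* (con 1 :+ h) :* a :+ (con 2 :* g :+ (con 2 :+ h)) :* b :+ con 2 :* r
             := con 2 :* (r :* r) :+ con 2 :* a :+ (con 2 :* g :+ (con 2 :+ h)) :* b :+ con 2 :* r :+ h :* (con 2 :* a)) refl a b h g ⟩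
      base + h * (2 * a)
        ≤⟨ ℕₚ.+-monoʳ-≤ base (ℕₚ.*-monoʳ-≤ h 2a≤b) ⟩
      base + h * b
        ≡⟨ solve 4 (λ a b h g → let r = con 1 :+ h :+ g in
             con 2 :* (r :* r) :+ con 2 :* a :+ (con 2 :* g :+ (con 2 :+ h)) :* b :+ con 2 :* r :+ h :* b
             := con 2 :* (r :+ b) :* r :+ con 2 :* (r :+ a)) refl a b h g ⟩
      2 * (r + b) * r + 2 * (r + a) ∎
      where
      open ℕₚ.≤-Reasoning
      open +-*-Solver
      r base : ℕ
      r = suc h + g
      base = 2 * (r * r) + 2 * a + (2 * g + suc (suc h)) * b + 2 * r

  exponent-≤-expo : ∀ m n r h → r ≤ m → r ≤ n → 1 ≤ h → h ≤ r → exponent m n r h ≤ expo m n r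
  exponent-≤-expo m n r h@(suc h′) r≤m r≤n _ h≤r
    with m ∸ r | ℕₚ.m+[n∸m]≡n r≤m | n ∸ r | ℕₚ.m+[n∸m]≡n r≤n | r ∸ h | ℕₚ.m+[n∸m]≡n h≤r
  ... | a | refl | b | refl | g | refl with (r + b) + r ≤? 2 * (r + a)
  ...   | yes p = ℕₚ.m+n≤o⇒m≤o∸n _ (exponent-≤-large a b h g (ℕₚ.+-cancelˡ-≤ (r + r) b (2 * a)
            (subst₂ _≤_ (solve 2 (λ r b → r :+ b :+ r := r :+ r :+ b) refl r b)
              (solve 2 (λ r a → con 2 :* (r :+ a) := r :+ r :+ con 2 :* a) refl r a) p)))
          where open +-*-Solver
  ...   | no p = ℕₚ.m+n≤o⇒m≤o∸n _ (exponent-≤-small a b h′ g (ℕₚ.+-cancelˡ-≤ (r + r) (2 * a) b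
            (subst₂ _≤_ (solve 2 (λ r a → con 2 :* (r :+ a) := r :+ r :+ con 2 :* a) refl r a)
              (solve 2 (λ r b → r :+ b :+ r := r :+ r :+ b) refl r b) (ℕₚ.≰⇒≥ p))))
          where open +-*-Solver

  module _ (H D : ℕ) (1≤H : 1 ≤ H) (1≤D : 1 ≤ D) where

    private
      -- One quantity for everything that is H^o(1): it dominates the constants 2 and 6 as well as
      -- `D * D`, so each factor of the count is bounded by a monomial in `κ` and `H`.
      κ : ℕ
      κ = 6 * (D * D)

      6≤κ : 6 ≤ κ
      6≤κ = ℕₚ.*-monoʳ-≤ 6 (ℕₚ.*-mono-≤ 1≤D 1≤D)

      instance
        κ≢0 : NonZero κ
        κ≢0 = >-nonZero (ℕₚ.≤-trans (s≤s z≤n) 6≤κ)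
        H≢0 : NonZero H
        H≢0 = >-nonZero 1≤H

      mon : ℕ → ℕ → ℕ
      mon i j = κ ^ i * H ^ j

      mon-* : ∀ i j k l → mon i j * mon k l ≡ mon (i + k) (j + l)
      mon-* i j k l = trans
        (solve 4 (λ a b c d → a :* b :* (c :* d) := a :* c :* (b :* d)) refl (κ ^ i) (H ^ j) (κ ^ k) (H ^ l))
        (sym (cong₂ _*_ (ℕₚ.^-distribˡ-+-* κ i k) (ℕₚ.^-distribˡ-+-* H j l)))
        where open +-*-Solver

      mon-^ : ∀ i j k → mon i j ^ k ≡ mon (i * k) (j * k)
      mon-^ i j k = trans (^-distrib-* (κ ^ i) (H ^ j) k) (cong₂ _*_ (ℕₚ.^-*-assoc κ i k) (ℕₚ.^-*-assoc H j k))

      -- A record and not an abbreviation of the inequality, so that the exponents are found by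
      -- unification and need not be read off from products of powers.
      record _≲_ (x : ℕ) (ij : ℕ × ℕ) : Set where
        constructor ≲⁺
        field ≲⁻ : x ≤ mon (proj₁ ij) (proj₂ ij)
      open _≲_

      _⊛_ : ∀ {x y i j k l} → x ≲ (i , j) → y ≲ (k , l) → (x * y) ≲ (i + k , j + l)
      _⊛_ {i = i} {j} {k} {l} (≲⁺ p) (≲⁺ q) = ≲⁺ $ ℕₚ.≤-trans (ℕₚ.*-mono-≤ p q) (ℕₚ.≤-reflexive (mon-* i j k l))

      _↑_ : ∀ {x i j} → x ≲ (i , j) → ∀ k → (x ^ k) ≲ (i * k , j * k)
      _↑_ {i = i} {j} (≲⁺ p) k = ≲⁺ $ ℕₚ.≤-trans (ℕₚ.^-monoˡ-≤ k p) (ℕₚ.≤-reflexive (mon-^ i j k))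

      G E : ℕ
      G = 3 * H * (2 * H)
      E = 3 * H * (D * D)

      G≤ : G ≲ (1 , 2)
      G≤ = ≲⁺ $ begin
        3 * H * (2 * H)    ≡⟨ solve 1 (λ h → con 3 :* h :* (con 2 :* h) := con 6 :* (h :* (h :* con 1))) refl H ⟩
        6 * H ^ 2          ≤⟨ ℕₚ.*-monoˡ-≤ (H ^ 2) 6≤κ ⟩
        κ * H ^ 2          ≡⟨ cong (_* H ^ 2) (ℕₚ.^-identityʳ κ) ⟨
        mon 1 2            ∎
        where
        open ℕₚ.≤-Reasoning
        open +-*-Solver

      E≤ : E ≲ (1 , 1)
      E≤ = ≲⁺ $ begin
        3 * H * (D * D)          ≤⟨ ℕₚ.*-monoˡ-≤ (D * D) (ℕₚ.*-monoˡ-≤ H (ℕₚ.m≤m+n 3 3)) ⟩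
        6 * H * (D * D)          ≡⟨ solve 2 (λ h d → con 6 :* h :* d := con 6 :* d :* con 1 :* (h :* con 1)) refl H (D * D) ⟩
        mon 1 1                  ∎
        where
        open ℕₚ.≤-Reasoning
        open +-*-Solver

      2≤ : 2 ≲ (1 , 0)
      2≤ = ≲⁺ $ ℕₚ.≤-trans (ℕₚ.≤-trans (ℕₚ.m≤m+n 2 4) 6≤κ)
        (ℕₚ.≤-reflexive (trans (sym (ℕₚ.^-identityʳ κ)) (sym (ℕₚ.*-identityʳ (κ ^ 1)))))

    κ-exponent : ℕ → ℕ → ℕ → ℕ
    κ-exponent m n r = r * r + (r + r) * m + suc r * n

    stages-≤ : ∀ m n r h → r ≤ m → r ≤ n → 1 ≤ h → h ≤ r →
      (G ^ r) ^ r * ((2 ^ r * G ^ h) ^ (m ∸ r) * (G ^ (r ∸ h) * E ^ suc h) ^ (n ∸ r)) ≤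
      κ ^ κ-exponent m n r * H ^ expo m n r
    stages-≤ m n r h r≤m r≤n 1≤h h≤r = begin
      (G ^ r) ^ r * ((2 ^ r * G ^ h) ^ a * (G ^ g * E ^ suc h) ^ b)
        ≤⟨ ≲⁻ (((G≤ ↑ r) ↑ r) ⊛ ((((2≤ ↑ r) ⊛ (G≤ ↑ h)) ↑ a) ⊛ (((G≤ ↑ g) ⊛ (E≤ ↑ suc h)) ↑ b))) ⟩
      mon (1 * r * r + ((1 * r + 1 * h) * a + (1 * g + 1 * suc h) * b)) (2 * r * r + ((0 * r + 2 * h) * a + (2 * g + 1 * suc h) * b))
        ≤⟨ ℕₚ.*-mono-≤ (ℕₚ.^-monoʳ-≤ κ κ-exp) (ℕₚ.^-monoʳ-≤ H (ℕₚ.≤-trans (ℕₚ.≤-reflexive H-exp) (exponent-≤-expo m n r h r≤m r≤n 1≤h h≤r))) ⟩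
      κ ^ κ-exponent m n r * H ^ expo m n r ∎
      where
      open ℕₚ.≤-Reasoning
      open +-*-Solver
      a b g : ℕ
      a = m ∸ r
      b = n ∸ r
      g = r ∸ h
      H-exp : 2 * r * r + ((0 * r + 2 * h) * a + (2 * g + 1 * suc h) * b) ≡ exponent m n r h
      H-exp = solve 5 (λ r h a b g → con 2 :* r :* r :+ ((con 2 :* h) :* a :+ (con 2 :* g :+ con 1 :* (con 1 :+ h)) :* b)
        := con 2 :* (r :* r) :+ con 2 :* h :* a :+ (con 2 :* g :+ (con 1 :+ h)) :* b) refl r h a b g
      κ-exp : 1 * r * r + ((1 * r + 1 * h) * a + (1 * g + 1 * suc h) * b) ≤ κ-exponent m n r
      κ-exp = begin
        1 * r * r + ((1 * r + 1 * h) * a + (1 * g + 1 * suc h) * b)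
          ≡⟨ solve 5 (λ r h a b g → con 1 :* r :* r :+ ((con 1 :* r :+ con 1 :* h) :* a :+ (con 1 :* g :+ con 1 :* (con 1 :+ h)) :* b)
               := r :* r :+ (r :+ h) :* a :+ (con 1 :+ (h :+ g)) :* b) refl r h a b g ⟩
        r * r + (r + h) * a + suc (h + g) * b
          ≡⟨ cong (λ t → r * r + (r + h) * a + suc t * b) (ℕₚ.m+[n∸m]≡n h≤r) ⟩
        r * r + (r + h) * a + suc r * b
          ≤⟨ ℕₚ.+-mono-≤ (ℕₚ.+-monoʳ-≤ (r * r) (ℕₚ.*-mono-≤ (ℕₚ.+-monoʳ-≤ r h≤r) (ℕₚ.m∸n≤m m r))) (ℕₚ.*-monoʳ-≤ (suc r) (ℕₚ.m∸n≤m n r)) ⟩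
        κ-exponent m n r ∎

open Bounds

-- Counting the matrices of a given shape and of a given rank.

module Matrices where

  open import Data.Nat.Divisibility using (_∣_; ∣-refl)
  open import Data.Rational using (_+_; _*_; -_)
  open ℚSolver using (module +-*-Solver)

  private
    _≟ᵛ_ : ∀ {s} → DecidableEquality (Vec ℚ s)
    _≟ᵛ_ = Vecₚ.≡-dec ℚₚ._≟_

  -- The discrete data of a matrix. There are finitely many shapes, their number does not involve
  -- `H`, and fixing one costs only a constant.
  record Shape (m n r : ℕ) : Set where
    constructor shape
    field
      rows : Vec (Fin m) r
      columns : Vec (Fin n) r
      widest : Fin m
      width : Fin (suc r)
    σ : Fin r → Fin m
    σ = lookup rows
    π : Fin r → Fin n
    π = lookup columns
    h : ℕ
    h = toℕ width

  -- σ, π and h are those of the introduction; the combination of row widest has exactly h terms.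
  record HasShape {m n r : ℕ} (S : Shape m n r) (A : Matrix m n) : Set where
    open Shape S
    field
      σ-injective : Injective _≡_ _≡_ σ
      π-injective : Injective _≡_ _≡_ π
      σ-independent : Independent (entry A ∘ σ)
      σπ-independent : Independent (λ s t → entry A (σ s) (π t))
      coefficient : Fin m → Fin r → ℚ
      factors : ∀ i k → entry A i k ≡ comb (coefficient i) (entry A ∘ σ) k
      coefficient-σ : ∀ t s → coefficient (σ t) s ≡ unit t s
      support≤h : ∀ i → support (coefficient i) ≤ h
      support-widest : support (coefficient widest) ≡ h
      h≥1 : 1 ≤ h

  shape-exists : ∀ {m n r} → 1 ≤ r → (A : Matrix m n) → RankFactorisation r A →
    Σ (Shape m n r) λ S → HasShape S A
  shape-exists {zero} {n} {suc r} _ A F with RankFactorisation.row F zero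
  ... | ()
  shape-exists {suc m} {n} {r@(suc _)} _ A F = S , record
    { σ-injective = F.row-injective
    ; π-injective = λ {s} {t} e → P.injective (trans (sym (π≗ s)) (trans e (π≗ t)))
    ; σ-independent = F.row-independent
    ; σπ-independent = λ c hyp → P.independent c λ t → subst (λ k → comb c (entry A ∘ F.row) k ≡ 0ℚ) (π≗ t) (hyp t)
    ; coefficient = F.coefficient
    ; factors = F.factors
    ; coefficient-σ = F.coefficient-row
    ; support≤h = λ i → ℕₚ.≤-trans (proj₂ am i) (ℕₚ.≤-reflexive (sym h≡))
    ; support-widest = sym h≡
    -- A basis row has a unit vector as its coefficients, and so one nonzero term.
    ; h≥1 = ℕₚ.≤-trans (support>0 (F.coefficient (F.row zero)) zero row-zero≢0)
        (ℕₚ.≤-trans (proj₂ am (F.row zero)) (ℕₚ.≤-reflexive (sym h≡)))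
    }
    where
    module F = RankFactorisation F
    module P = Pivots (pivots (entry A ∘ F.row) F.row-independent)
    π≗ : ∀ t → lookup (Vec.tabulate P.column) t ≡ P.column t
    π≗ = Vecₚ.lookup∘tabulate P.column
    am : Σ (Fin (suc m)) λ i → ∀ j → support (F.coefficient j) ≤ support (F.coefficient i)
    am = argmax (λ i → support (F.coefficient i))
    h< : support (F.coefficient (proj₁ am)) < suc r
    h< = s≤s (support-≤ (F.coefficient (proj₁ am)))
    S : Shape (suc m) n r
    S = shape F.rows (Vec.tabulate P.column) (proj₁ am) (fromℕ< h<)
    h≡ : toℕ (fromℕ< h<) ≡ support (F.coefficient (proj₁ am))
    h≡ = Finₚ.toℕ-fromℕ< h<
    row-zero≢0 : F.coefficient (F.row zero) zero ≢ 0ℚ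
    row-zero≢0 e = unit-nonzero {r} zero (trans (sym (F.coefficient-row zero zero)) e)

  shapes : ℕ → ℕ → ℕ → ℕ
  shapes m n r = ∏ {r} (λ _ → m) ℕ.* ∏ {r} (λ _ → n) ℕ.* (m ℕ.* suc r)

  private
    ShapeCode : ℕ → ℕ → ℕ → Set
    ShapeCode m n r = (Vec (Fin m) r × Vec (Fin n) r) × (Fin m × Fin (suc r))

    decode : ∀ {m n r} → ShapeCode m n r → Shape m n r
    decode ((a , b) , (c , d)) = shape a b c d

    encode : ∀ {m n r} → Shape m n r → ShapeCode m n r
    encode (shape a b c d) = (a , b) , (c , d)

    _≟ᶜ_ : ∀ {m n r} → DecidableEquality (ShapeCode m n r)
    _≟ᶜ_ = Productₚ.≡-dec (Productₚ.≡-dec (Vecₚ.≡-dec Finₚ._≟_) (Vecₚ.≡-dec Finₚ._≟_)) (Productₚ.≡-dec Finₚ._≟_ Finₚ._≟_)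

  _≟ˢ_ : ∀ {m n r} → DecidableEquality (Shape m n r)
  S ≟ˢ S′ with encode S ≟ᶜ encode S′
  ... | yes e = yes (cong decode e)
  ... | no ne = no (ne ∘ cong encode)

  count-shapes : ∀ {m n r} (P : Shape m n r → Set) → Count P (shapes m n r)
  count-shapes P = count-inj _≟ᶜ_ encode
    (count-× (Productₚ.≡-dec (Vecₚ.≡-dec Finₚ._≟_) (Vecₚ.≡-dec Finₚ._≟_)) (Productₚ.≡-dec Finₚ._≟_ Finₚ._≟_)
      (count-× (Vecₚ.≡-dec Finₚ._≟_) (Vecₚ.≡-dec Finₚ._≟_)
        (count-Vec Finₚ._≟_ λ _ → count-Fin λ _ → ⊤) (count-Vec Finₚ._≟_ λ _ → count-Fin λ _ → ⊤))
      (count-× Finₚ._≟_ Finₚ._≟_ (count-Fin λ _ → ⊤) (count-Fin λ _ → ⊤)))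
    (λ _ _ → ((λ _ → tt) , (λ _ → tt)) , (tt , tt))
    λ _ _ _ _ → cong decode

  module _ (H D X : ℕ) (2≤H : 2 ≤ H) (3H≤X : 3 ℕ.* H ≤ X)
    (divisors : ∀ n → 0 < n → n ≤ X → Count (_∣ n) D) where

    private
      1≤H : 1 ≤ H
      1≤H = ℕₚ.≤-trans (s≤s z≤n) 2≤H
      instance
        H≢0 : NonZero H
        H≢0 = >-nonZero 1≤H
      G E : ℕ
      G = |𝓕| H
      E = 3 ℕ.* H ℕ.* (D ℕ.* D)
      1≤D : 1 ≤ D
      -- The list consisting of 1 alone is a list of divisors of 1.
      1≤D = divisors 1 (s≤s z≤n) (ℕₚ.≤-trans (ℕₚ.*-mono-≤ {1} {3} (s≤s z≤n) 1≤H) 3H≤X)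
        (1 ∷ []) ([] AllPairs.∷ AllPairs.[]) (∣-refl ∷ [])
      1≤G : 1 ≤ G
      1≤G = ℕₚ.*-mono-≤ {1} {_} {1} (ℕₚ.*-mono-≤ {1} {3} (s≤s z≤n) 1≤H) (ℕₚ.*-mono-≤ {1} {2} (s≤s z≤n) 1≤H)
      1≤E : 1 ≤ E
      1≤E = ℕₚ.*-mono-≤ {1} {_} {1} (ℕₚ.*-mono-≤ {1} {3} (s≤s z≤n) 1≤H) (ℕₚ.*-mono-≤ 1≤D 1≤D)
      1≤^ : ∀ {x} k → 1 ≤ x → 1 ≤ x ℕ.^ k
      1≤^ {x} k p = ℕₚ.m^n>0 x {{>-nonZero p}} k

    module Stages {m n r : ℕ} (S : Shape m n r) (small : H ℕ.^ suc r ℕ.* (H ℕ.^ coefficient-height r) ℕ.^ suc r ≤ X) where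

      open Shape S

      private
        T : ℕ
        T = H ℕ.^ coefficient-height r

      InH : ∀ {s} → Vec ℚ s → Set
      InH v = ∀ i → InF H (lookup v i)

      module _ (B : Vec (Vec ℚ r) r) (B-independent : Independent (entry B)) where

        -- The second clause is row `i` of `A` on the columns `π`, written through `B`; independence
        -- of the rows of `B` recovers `l` from it. The third leaves a single choice for each basis
        -- row, so only the other rows count.
        CoefficientRow : Fin m → Vec ℚ r → Set
        CoefficientRow i l = support (lookup l) ≤ h × (∀ t → InF H (comb (lookup l) (entry B) t)) ×
          (∀ t → σ t ≡ i → ∀ s → lookup l s ≡ unit t s)

        count-coefficient-row : ∀ i → Count (CoefficientRow i) (oneIf (inImage? σ i) (2 ℕ.^ r ℕ.* G ℕ.^ h))
        count-coefficient-row i = by-cases (inImage? σ i)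
          where
          by-cases : (d : Dec _) → Count (CoefficientRow i) (oneIf d (2 ℕ.^ r ℕ.* G ℕ.^ h))
          by-cases (yes (t , e)) = count-≤1 λ l l′ (_ , _ , u) (_ , _ , u′) →
            lookup-ext l l′ λ s → trans (u t e s) (sym (u′ t e s))
          by-cases (no _) = count-inj _≟ᵛ_ (λ l → Vec.tabulate (comb (lookup l) (entry B)))
            (count-affine-span 1≤H h (λ _ → 0ℚ) (entry B))
            (λ l (s , f , _) → (λ k → subst (InF H) (sym (Vecₚ.lookup∘tabulate (comb (lookup l) (entry B)) k)) (f k)) ,
              lookup l , s , λ k → trans (Vecₚ.lookup∘tabulate (comb (lookup l) (entry B)) k)
                (sym (ℚₚ.+-identityˡ (comb (lookup l) (entry B) k))))
            λ l l′ _ _ e → lookup-ext l l′ (comb-unique B-independent (lookup l) (lookup l′) λ k →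
              trans (sym (Vecₚ.lookup∘tabulate (comb (lookup l) (entry B)) k))
                (trans (cong (λ v → lookup v k) e) (Vecₚ.lookup∘tabulate (comb (lookup l′) (entry B)) k)))

        module _ (l : Vec ℚ r) (l-height : ∀ s → InF T (lookup l s)) (l-support : support (lookup l) ≡ h) where

          -- Row `widest` minus its combination, up to sign; the head supplies the extra nonzero
          -- term. If `widest` is itself a basis row, then `h = 1` and the equation equates an entry
          -- with its copy.
          relation : Fin (suc r) → ℚ
          relation zero = - 1ℚ
          relation (suc s) = lookup l s

          -- `z` holds the entry of row `widest`, then those of the basis rows. In a pivot column
          -- the latter are already in `B` and the equation gives the former, so one choice remains.
          Column : Fin n → Vec ℚ (suc r) → Set
          Column j z = (InH z × sum (λ i → relation i * lookup z i) ≡ 0ℚ) ×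
            (∀ t → π t ≡ j → ∀ s → lookup z (suc s) ≡ entry B s t)

          private
            1≤T : 1 ≤ T
            1≤T = 1≤^ (coefficient-height r) 1≤H
            relation-height : ∀ i → InF T (relation i)
            relation-height zero = 1≤T , 1≤T
            relation-height (suc s) = l-height s
            relation-support : support relation ≡ suc h
            relation-support = cong suc l-support
            head-determined : ∀ z → sum (λ i → relation i * lookup z i) ≡ 0ℚ →
              lookup z zero ≡ sum (λ s → lookup l s * lookup z (suc s))
            head-determined z e = trans (sym (ℚₚ.+-identityʳ (lookup z zero)))
              (trans (cong (λ t → lookup z zero + t) (sym e))
                (solve 2 (λ a b → a :+ ((:- con 1ℚ) :* a :+ b) := b) refl (lookup z zero) (sum (λ s → lookup l s * lookup z (suc s)))))
              where open +-*-Solver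

          count-column : ∀ j → Count (Column j) (oneIf (inImage? π j) (G ℕ.^ (r ℕ.∸ h) ℕ.* E ℕ.^ suc h))
          count-column j = by-cases (inImage? π j)
            where
            by-cases : (d : Dec _) → Count (Column j) (oneIf d (G ℕ.^ (r ℕ.∸ h) ℕ.* E ℕ.^ suc h))
            by-cases (no _) = count-⊆ (λ _ → proj₁)
              (ℕₚ.≤-reflexive (cong (λ k → G ℕ.^ (suc r ℕ.∸ k) ℕ.* E ℕ.^ k) relation-support))
              (count-equation H D X 1≤H 3H≤X divisors relation relation-height small)
            by-cases (yes (t , e)) = count-≤1 λ z z′ ((_ , q) , u) ((_ , q′) , u′) →
              let same = λ s → trans (u t e s) (sym (u′ t e s)) in
              lookup-ext z z′ λ { zero → trans (head-determined z q)
                                    (trans (sum-cong-≗ λ s → cong (lookup l s *_) (same s)) (sym (head-determined z′ q′)))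
                                ; (suc s) → same s }

      P : Matrix m n → Set
      P A = InM H A × HasShape S A

      Block : Matrix m n → Vec (Vec ℚ r) r → Set
      Block A B = ∀ s t → entry B s t ≡ entry A (σ s) (π t)

      GoodBlock : Vec (Vec ℚ r) r → Set
      GoodBlock B = (∀ s t → InF H (entry B s t)) × Independent (entry B)

      block : Matrix m n → Vec (Vec ℚ r) r
      block A = Vec.tabulate λ s → Vec.tabulate λ t → entry A (σ s) (π t)

      block-correct : ∀ A → Block A (block A)
      block-correct A s t = trans (cong (λ v → lookup v t) (Vecₚ.lookup∘tabulate (λ s → Vec.tabulate λ t → entry A (σ s) (π t)) s))
        (Vecₚ.lookup∘tabulate (λ t → entry A (σ s) (π t)) t)

      count-blocks : Count GoodBlock ((G ℕ.^ r) ℕ.^ r)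
      count-blocks = count-⊆ (λ _ → proj₁)
        (ℕₚ.≤-reflexive (trans (∏-const r (∏ {r} λ _ → G)) (cong (ℕ._^ r) (∏-const r G))))
        (count-Vec _≟ᵛ_ λ _ → count-Vec ℚₚ._≟_ λ _ → count-𝓕 1≤H)

      Coefficients : Matrix m n → Vec (Vec ℚ r) m → Set
      Coefficients A Λ = ∀ i k → entry A i k ≡ comb (entry Λ i) (entry A ∘ σ) k

      -- A height bound is asked of row `widest` alone, the one whose coefficients become an
      -- equation.
      GoodCoefficients : (B : Vec (Vec ℚ r) r) → Independent (entry B) → Vec (Vec ℚ r) m → Set
      GoodCoefficients B ind Λ = (∀ i → CoefficientRow B ind i (lookup Λ i)) ×
        (∀ s → InF T (entry Λ widest s)) × support (entry Λ widest) ≡ h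

      block-independent : ∀ {A B} → HasShape S A → Block A B → Independent (entry B)
      block-independent {A} {B} sh b c hyp = HasShape.σπ-independent sh c λ t →
        trans (sum-cong-≗ λ s → cong (c s *_) (sym (b s t))) (hyp t)

      coefficients-exist : ∀ A B ind → P A → Block A B → Σ (Vec (Vec ℚ r) m) λ Λ → GoodCoefficients B ind Λ × Coefficients A Λ
      coefficients-exist A B ind (A∈ , sh) b = Λ ,
          ((λ i → ℕₚ.≤-trans (ℕₚ.≤-reflexive (support-cong (Λ≗ i))) (support≤h i) ,
            (λ t → subst (InF H) (trans (factors i (π t)) (sum-cong-≗ λ s →
                cong₂ _*_ (sym (Λ≗ i s)) (sym (b s t)))) (A∈ i (π t))) ,
            λ { t refl s → trans (Λ≗ i s) (coefficient-σ t s) }) ,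
           (λ s → subst (InF T) (sym (Λ≗ widest s)) (InF-coefficients (entry A ∘ σ) (entry A widest) (coefficient widest)
              2≤H σ-independent (λ i k → A∈ (σ i) k) (A∈ widest) (factors widest) s)) ,
           trans (support-cong (Λ≗ widest)) support-widest) ,
          λ i k → trans (factors i k) (sum-cong-≗ λ s → cong (_* entry A (σ s) k) (sym (Λ≗ i s)))
        where
        open HasShape sh
        Λ : Vec (Vec ℚ r) m
        Λ = Vec.tabulate λ i → Vec.tabulate (coefficient i)
        Λ≗ : ∀ i s → entry Λ i s ≡ coefficient i s
        Λ≗ i s = trans (cong (λ v → lookup v s) (Vecₚ.lookup∘tabulate (λ i → Vec.tabulate (coefficient i)) i))
          (Vecₚ.lookup∘tabulate (coefficient i) s)

      column : Matrix m n → Fin n → Vec ℚ (suc r)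
      column A j = entry A widest j ∷ Vec.tabulate λ s → entry A (σ s) j

      column-suc : ∀ A j s → lookup (column A j) (suc s) ≡ entry A (σ s) j
      column-suc A j s = Vecₚ.lookup∘tabulate (λ s → entry A (σ s) j) s

      column-relation : ∀ A B ind Λ (good : GoodCoefficients B ind Λ) → Coefficients A Λ → ∀ j →
        sum (λ i → relation B ind (lookup Λ widest) (proj₁ (proj₂ good)) (proj₂ (proj₂ good)) i * lookup (column A j) i) ≡ 0ℚ
      column-relation A B ind Λ good co j = begin
        (- 1ℚ) * a + sum (λ s → entry Λ widest s * lookup (column A j) (suc s))
          ≡⟨ cong (λ t → (- 1ℚ) * a + t) (sum-cong-≗ λ s → cong (entry Λ widest s *_) (column-suc A j s)) ⟩
        (- 1ℚ) * a + comb (entry Λ widest) (entry A ∘ σ) j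
          ≡⟨ cong (λ t → (- 1ℚ) * a + t) (co widest j) ⟨
        (- 1ℚ) * a + a
          ≡⟨ solve 1 (λ a → (:- con 1ℚ) :* a :+ a := con 0ℚ) refl a ⟩
        0ℚ ∎
        where
        open ≡-Reasoning
        open +-*-Solver
        a : ℚ
        a = entry A widest j

      Columns : Matrix m n → Vec (Vec ℚ (suc r)) n → Set
      Columns A Z = ∀ j → lookup Z j ≡ column A j

      -- The columns contain the basis rows in full, and `Λ` rebuilds every row from them.
      determined : ∀ {Λ Z A A′} → Coefficients A Λ → Coefficients A′ Λ → Columns A Z → Columns A′ Z → A ≡ A′
      determined {Λ} {Z} {A} {A′} co co′ cols cols′ = lookup-ext A A′ λ i → lookup-ext _ _ λ k →
        trans (co i k) (trans (sum-cong-≗ λ s → cong (entry Λ i s *_) (begin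
          entry A (σ s) k              ≡⟨ column-suc A k s ⟨
          lookup (column A k) (suc s)  ≡⟨ cong (λ v → lookup v (suc s)) (trans (sym (cols k)) (cols′ k)) ⟩
          lookup (column A′ k) (suc s) ≡⟨ column-suc A′ k s ⟩
          entry A′ (σ s) k             ∎)) (sym (co′ i k)))
        where open ≡-Reasoning

      count-shape : Injective _≡_ _≡_ σ → Injective _≡_ _≡_ π → Count P ((G ℕ.^ r) ℕ.^ r ℕ.*
        ((2 ℕ.^ r ℕ.* G ℕ.^ h) ℕ.^ (m ℕ.∸ r) ℕ.* (G ℕ.^ (r ℕ.∸ h) ℕ.* E ℕ.^ suc h) ℕ.^ (n ℕ.∸ r)))
      count-shape σ-inj π-inj =
        count-fibre (Vecₚ.≡-dec _≟ᵛ_) {R = Block} count-blocks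
          (λ A (A∈ , sh) → block A ,
            ((λ s t → subst (InF H) (sym (block-correct A s t)) (A∈ (σ s) (π t))) ,
              block-independent {A} {block A} sh (block-correct A)) , block-correct A)
        λ B (_ , ind) →
        count-fibre (Vecₚ.≡-dec _≟ᵛ_) {Q = GoodCoefficients B ind} {R = Coefficients}
          (count-⊆ (λ _ → proj₁) (∏-outside-image σ σ-inj _ (ℕₚ.*-mono-≤ (1≤^ r (s≤s z≤n)) (1≤^ h 1≤G)))
            (count-Vec _≟ᵛ_ (count-coefficient-row B ind)))
          (λ A (p , b) → coefficients-exist A B ind p b)
        λ Λ good →
        count-rel (Vecₚ.≡-dec _≟ᵛ_) Columns
          (count-⊆ (λ _ p → p) (∏-outside-image π π-inj _ (ℕₚ.*-mono-≤ (1≤^ (r ℕ.∸ h) 1≤G) (1≤^ (suc h) 1≤E)))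
            (count-Vec _≟ᵛ_ (count-column B ind (lookup Λ widest) (proj₁ (proj₂ good)) (proj₂ (proj₂ good)))))
          (λ A (((A∈ , sh) , b) , co) → Vec.tabulate (column A) ,
            (λ j → subst (Column B ind (lookup Λ widest) (proj₁ (proj₂ good)) (proj₂ (proj₂ good)) j)
              (sym (Vecₚ.lookup∘tabulate (column A) j))
              (((λ { zero → A∈ widest j ; (suc s) → subst (InF H) (sym (column-suc A j s)) (A∈ (σ s) j) }) ,
                column-relation A B ind Λ good co j) ,
               λ { t refl s → trans (column-suc A j s) (sym (b s t)) })) ,
            Vecₚ.lookup∘tabulate (column A))
          λ A A′ Z _ (_ , co) (_ , co′) cols cols′ → determined {Λ} {Z} {A} {A′} co co′ cols cols′

    count-rank : ∀ {m n r} → 1 ≤ r → r ≤ m → r ≤ n →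
      H ℕ.^ suc r ℕ.* (H ℕ.^ coefficient-height r) ℕ.^ suc r ≤ X →
      Count (λ (A : Matrix m n) → InM H A × HasRank A r)
        (shapes m n r ℕ.* ((6 ℕ.* (D ℕ.* D)) ℕ.^ κ-exponent H D 1≤H 1≤D m n r ℕ.* H ℕ.^ expo m n r))
    count-rank {m} {n} {r} 1≤r r≤m r≤n small =
      count-¬¬ {Q = λ A → InM H A × RankFactorisation r A}
        (λ A (A∈ , rk) k → hasRank⇒factorisation A rk λ F → k (A∈ , F))
        (count-fibre _≟ˢ_ {Q = Admissible} {R = λ A S → HasShape S A} (count-shapes Admissible)
          (λ A (_ , F) → admissible (shape-exists 1≤r A F))
          λ S (σ-inj , π-inj , 1≤h) → count-⊆ (λ A ((A∈ , _) , sh) → A∈ , sh)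
            (stages-≤ H D 1≤H 1≤D m n r (Shape.h S) r≤m r≤n 1≤h (s≤s⁻¹ (Finₚ.toℕ<n (Shape.width S))))
            (Stages.count-shape S small σ-inj π-inj))
      where
      -- The part of `HasShape` that does not mention the matrix: the bound for a fibre has to be
      -- proved for the shape by itself.
      Admissible : Shape m n r → Set
      Admissible S = Injective _≡_ _≡_ (Shape.σ S) × Injective _≡_ _≡_ (Shape.π S) × 1 ≤ Shape.h S
      admissible : ∀ {A} → (Σ (Shape m n r) λ S → HasShape S A) → Σ (Shape m n r) λ S → Admissible S × HasShape S A
      admissible (S , sh) = S , (HasShape.σ-injective sh , HasShape.π-injective sh , HasShape.h≥1 sh) , sh

  -- Rank 0 stands apart because `h ≥ 1` fails; combinations of an empty basis leave only the zero
  -- matrix.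
  count-rank-0 : ∀ {m n} H → Count (λ (A : Matrix m n) → InM H A × HasRank A 0) 1
  count-rank-0 {m} {n} H = count-¬¬ {Q = RankFactorisation 0} (λ A (_ , rk) → hasRank⇒factorisation A rk)
    (count-≤1 λ A A′ F F′ → lookup-ext A A′ λ i → lookup-ext _ _ λ k →
      trans (RankFactorisation.factors F i k) (sym (RankFactorisation.factors F′ i k)))

  -- After squaring, the powers of `C` and of `D` are each at most `H`, so the square is at most
  -- `H ^ 2`.
  absorb-constant : ∀ C D e k H → D ℕ.^ suc (e ℕ.* suc k ℕ.* 2) ≤ H → 1 ≤ D → C ℕ.^ (suc k ℕ.* 2) ≤ H →
    (C ℕ.* D ℕ.^ e) ℕ.^ suc k ≤ H
  absorb-constant C D e k H D≤ 1≤D C≤ = ^-cancelʳ-≤ 1 (begin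
    ((C ℕ.* D ℕ.^ e) ℕ.^ suc k) ℕ.^ 2           ≡⟨ ℕₚ.^-*-assoc (C ℕ.* D ℕ.^ e) (suc k) 2 ⟩
    (C ℕ.* D ℕ.^ e) ℕ.^ (suc k ℕ.* 2)           ≡⟨ ^-distrib-* C (D ℕ.^ e) (suc k ℕ.* 2) ⟩
    C ℕ.^ (suc k ℕ.* 2) ℕ.* (D ℕ.^ e) ℕ.^ (suc k ℕ.* 2)
      ≡⟨ cong (λ t → C ℕ.^ (suc k ℕ.* 2) ℕ.* t) (trans (ℕₚ.^-*-assoc D e (suc k ℕ.* 2)) (cong (D ℕ.^_) (sym (ℕₚ.*-assoc e (suc k) 2)))) ⟩
    C ℕ.^ (suc k ℕ.* 2) ℕ.* D ℕ.^ (e ℕ.* suc k ℕ.* 2)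
      ≤⟨ ℕₚ.*-mono-≤ C≤ (ℕₚ.≤-trans (ℕₚ.^-monoʳ-≤ D {{>-nonZero 1≤D}} (ℕₚ.n≤1+n (e ℕ.* suc k ℕ.* 2))) D≤) ⟩
    H ℕ.* H                                     ≡⟨ cong (H ℕ.*_) (ℕₚ.*-identityʳ H) ⟨
    H ℕ.^ 2                                     ∎)
    where open ℕₚ.≤-Reasoning

open Matrices

-- Choice of the parameters and the final estimate.

open import Data.Nat using (_+_; _*_; _^_)
open import Data.Nat.Divisibility using (_∣_; ∣-refl)

-- `k` stands for ε = 1/(k + 1): the `suc k`-th power turns a bound by H^(expo + ε) into one between
-- natural numbers, and these ε become arbitrarily small.
theorem2p1 : ∀ (m n r : ℕ) → r < m → m ≤ n →
    ∀ (k : ℕ) → Σ ℕ (λ H₀ → ∀ (H : ℕ) → H₀ ≤ H →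
    ∀ (L : List (Matrix m n)) → Unique L →
    All (λ A → InM H A × HasRank A r) L →
    length L ^ suc k ≤ H ^ (expo m n r * suc k + 1))
theorem2p1 m n zero r<m m≤n k = 1 , λ H 1≤H L u a → ℕₚ.≤-trans (ℕₚ.^-monoˡ-≤ (suc k) (count-rank-0 H L u a))
  (ℕₚ.≤-trans (ℕₚ.≤-reflexive (ℕₚ.^-zeroˡ (suc k))) (ℕₚ.m^n>0 H {{>-nonZero 1≤H}} (expo m n 0 ℕ.* suc k ℕ.+ 1)))
theorem2p1 m n r@(suc r′) r<m m≤n k = H₀ , bound
  where
  s ch K e₀ e C H₁ H₀ : ℕ
  s = suc r
  ch = coefficient-height r
  -- The divisor bound is used up to `H ^ K`. The 2 secures `3 * H ≤ H ^ K`; the rest covers an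
  -- equation in `s` unknowns with coefficients of height `H ^ ch`.
  K = 2 ℕ.+ (s ℕ.+ ch ℕ.* s)
  -- This is `κ-exponent` written out: `H₀` has to be chosen before `H` and `D`, on which that
  -- module depends.
  e₀ = r ℕ.* r ℕ.+ (r ℕ.+ r) ℕ.* m ℕ.+ suc r ℕ.* n
  e = 2 ℕ.* e₀
  C = shapes m n r ℕ.* 6 ℕ.^ e₀
  -- The root is taken so deep that `D ^ (e * suc k * 2) ≤ H`, which is what `absorb-constant`
  -- consumes.
  H₁ = proj₁ (divisor-bound (e ℕ.* suc k ℕ.* 2) K)
  H₀ = 3 ℕ.+ (C ℕ.^ (suc k ℕ.* 2) ℕ.+ H₁)
  bound : ∀ H → H₀ ≤ H → ∀ L → Unique L → All (λ A → InM H A × HasRank A r) L →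
    length L ℕ.^ suc k ≤ H ℕ.^ (expo m n r ℕ.* suc k ℕ.+ 1)
  bound H H₀≤H L u a = begin
    length L ℕ.^ suc k
      ≤⟨ ℕₚ.^-monoˡ-≤ (suc k) (count-rank H D (H ℕ.^ K) 2≤H 3H≤ divs (s≤s z≤n) (ℕₚ.<⇒≤ r<m) (ℕₚ.≤-trans (ℕₚ.<⇒≤ r<m) m≤n) small L u a) ⟩
    (shapes m n r ℕ.* ((6 ℕ.* (D ℕ.* D)) ℕ.^ e₀ ℕ.* H ℕ.^ expo m n r)) ℕ.^ suc k
      ≡⟨ cong (ℕ._^ suc k) regroup ⟩
    (C ℕ.* D ℕ.^ e ℕ.* H ℕ.^ expo m n r) ℕ.^ suc k
      ≡⟨ ^-distrib-* (C ℕ.* D ℕ.^ e) (H ℕ.^ expo m n r) (suc k) ⟩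
    (C ℕ.* D ℕ.^ e) ℕ.^ suc k ℕ.* (H ℕ.^ expo m n r) ℕ.^ suc k
      ≤⟨ ℕₚ.*-mono-≤ (absorb-constant C D e k H D≤ 1≤D C≤) (ℕₚ.≤-reflexive (ℕₚ.^-*-assoc H (expo m n r) (suc k))) ⟩
    H ℕ.^ suc (expo m n r ℕ.* suc k)
      ≡⟨ cong (H ℕ.^_) (ℕₚ.+-comm 1 (expo m n r ℕ.* suc k)) ⟩
    H ℕ.^ (expo m n r ℕ.* suc k ℕ.+ 1) ∎
    where
    open ℕₚ.≤-Reasoning
    3≤H : 3 ≤ H
    3≤H = ℕₚ.≤-trans (ℕₚ.m≤m+n 3 _) H₀≤H
    2≤H : 2 ≤ H
    2≤H = ℕₚ.≤-trans (ℕₚ.n≤1+n 2) 3≤H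
    instance
      H≢0 : NonZero H
      H≢0 = >-nonZero (ℕₚ.≤-trans (s≤s z≤n) 3≤H)
    C≤ : C ℕ.^ (suc k ℕ.* 2) ≤ H
    C≤ = ℕₚ.≤-trans (ℕₚ.m≤m+n _ H₁) (ℕₚ.≤-trans (ℕₚ.m≤n+m _ 3) H₀≤H)
    db = proj₂ (divisor-bound (e ℕ.* suc k ℕ.* 2) K) H
      (ℕₚ.≤-trans (ℕₚ.m≤n+m H₁ _) (ℕₚ.≤-trans (ℕₚ.m≤n+m _ 3) H₀≤H))
    D : ℕ
    D = proj₁ db
    D≤ : D ℕ.^ suc (e ℕ.* suc k ℕ.* 2) ≤ H
    D≤ = proj₁ (proj₂ db)
    divs : ∀ n → 0 < n → n ≤ H ℕ.^ K → Count (_∣ n) D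
    divs = proj₂ (proj₂ db)
    1≤D : 1 ≤ D
    1≤D = divs 1 (s≤s z≤n) (ℕₚ.m^n>0 H K) (1 ∷ []) ([] AllPairs.∷ AllPairs.[]) (∣-refl ∷ [])
    3H≤ : 3 ℕ.* H ≤ H ℕ.^ K
    3H≤ = ℕₚ.≤-trans (ℕₚ.*-monoˡ-≤ H 3≤H) (ℕₚ.≤-trans (ℕₚ.≤-reflexive (cong (H ℕ.*_) (sym (ℕₚ.*-identityʳ H))))
      (ℕₚ.^-monoʳ-≤ H (ℕₚ.m≤m+n 2 (s ℕ.+ ch ℕ.* s))))
    small : H ℕ.^ s ℕ.* (H ℕ.^ ch) ℕ.^ s ≤ H ℕ.^ K
    small = begin
      H ℕ.^ s ℕ.* (H ℕ.^ ch) ℕ.^ s     ≡⟨ cong (H ℕ.^ s ℕ.*_) (ℕₚ.^-*-assoc H ch s) ⟩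
      H ℕ.^ s ℕ.* H ℕ.^ (ch ℕ.* s)     ≡⟨ ℕₚ.^-distribˡ-+-* H s (ch ℕ.* s) ⟨
      H ℕ.^ (s ℕ.+ ch ℕ.* s)           ≤⟨ ℕₚ.^-monoʳ-≤ H (ℕₚ.m≤n+m (s ℕ.+ ch ℕ.* s) 2) ⟩
      H ℕ.^ K                          ∎
    regroup : shapes m n r ℕ.* ((6 ℕ.* (D ℕ.* D)) ℕ.^ e₀ ℕ.* H ℕ.^ expo m n r) ≡ C ℕ.* D ℕ.^ e ℕ.* H ℕ.^ expo m n r
    regroup = begin-equality
      shapes m n r ℕ.* ((6 ℕ.* (D ℕ.* D)) ℕ.^ e₀ ℕ.* H ℕ.^ expo m n r)
        ≡⟨ cong (λ t → shapes m n r ℕ.* (t ℕ.* H ℕ.^ expo m n r)) (trans (^-distrib-* 6 (D ℕ.* D) e₀)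
             (cong (6 ℕ.^ e₀ ℕ.*_) (trans (cong (λ t → (D ℕ.* t) ℕ.^ e₀) (sym (ℕₚ.*-identityʳ D))) (ℕₚ.^-*-assoc D 2 e₀)))) ⟩
      shapes m n r ℕ.* (6 ℕ.^ e₀ ℕ.* D ℕ.^ e ℕ.* H ℕ.^ expo m n r)
        ≡⟨ solve 4 (λ a b c d → a :* (b :* c :* d) := a :* b :* c :* d) refl (shapes m n r) (6 ℕ.^ e₀) (D ℕ.^ e) (H ℕ.^ expo m n r) ⟩
      C ℕ.* D ℕ.^ e ℕ.* H ℕ.^ expo m n r ∎
      where open ℕSolver.+-*-Solver
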